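{- There is a constant $c$ such that for all binary strings $a,b$, \[ \bigl|\, C(a,b) - \bigl( K(a \mid C(a,b)) + C(b \mid a, C(a,b)) \bigr) \bigr| \le c . \]
   Context: $C(u)$ denotes plain Kolmogorov complexity (the minimal length of a program producing $u$ on a fixed optimal universal machine) and $C(u\mid v)$ the conditional plain complexity (minimal length of a program mapping $v$ to $u$). $K(u\mid v)$ denotes conditional prefix-free Kolmogorov complexity (defined via an optimal machine whose domain, for each fixed condition, is prefix-free, i.e. programs are self-delimiting). Pairs and tuples of strings/natural numbers are encoded as strings by a fixed computable injective encoding; natural numbers are identified with binary strings in the standard way. The constant $c$ depends only on the choice of the optimal machines and encodings, not on $a,b$. -}

module Defs where

open import Data.Nat using (ℕ; zero; suc; _+_; _*_; _∸_; _≤_)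
open import Data.Bool using (Bool; true; false)
open import Data.List using (List; []; _∷_; _++_; length; reverse)
open import Data.Vec using (Vec; []; _∷_; lookup)
open import Data.Fin using (Fin)
open import Data.Maybe using (Maybe; just; nothing; _>>=_)
open import Data.Product using (Σ; ∃; _×_; _,_)
open import Relation.Binary.PropositionalEquality using (_≡_)

-- Binary strings and the standard identification with ℕ
-- ("" ↦ 0, "0" ↦ 1, "1" ↦ 2, "00" ↦ 3, ...), strings written MSB first.

Str : Set
Str = List Bool

bit : Bool → ℕ
bit false = 0
bit true  = 1

numFrom : ℕ → Str → ℕ
numFrom acc []      = acc
numFrom acc (b ∷ s) = numFrom (2 * acc + bit b) s

num : Str → ℕ
num s = numFrom 1 s ∸ 1

-- increment on LSB-first strings in the bijective order
incL : Str → Str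
incL []          = false ∷ []
incL (false ∷ s) = true ∷ s
incL (true ∷ s)  = false ∷ incL s

strL : ℕ → Str
strL zero    = []
strL (suc n) = incL (strL n)

str : ℕ → Str
str n = reverse (strL n)

dbl : Str → Str
dbl []      = []
dbl (x ∷ s) = x ∷ x ∷ dbl s

pair : Str → Str → Str
pair a b = dbl a ++ (false ∷ true ∷ b)

data PR : ℕ → Set where
  Z    : ∀ {n} → PR n
  S    : PR 1
  P    : ∀ {n} → Fin n → PR n
  Comp : ∀ {n m} → PR m → Vec (PR n) m → PR n
  Rec  : ∀ {n} → PR n → PR (suc (suc n)) → PR (suc n)
  Mu   : ∀ {n} → PR (suc n) → PR n

mutual
  eval : ∀ {n} → ℕ → PR n → Vec ℕ n → Maybe ℕ
  eval zero    _          _              = nothing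
  eval (suc k) Z          xs             = just 0
  eval (suc k) S          (x ∷ [])       = just (suc x)
  eval (suc k) (P i)      xs             = just (lookup xs i)
  eval (suc k) (Comp f gs) xs            = evalAll k gs xs >>= λ ys → eval k f ys
  eval (suc k) (Rec f g)  (zero ∷ xs)    = eval k f xs
  eval (suc k) (Rec f g)  (suc y ∷ xs)   =
    eval k (Rec f g) (y ∷ xs) >>= λ r → eval k g (y ∷ r ∷ xs)
  eval (suc k) (Mu f)     xs             = search k f xs 0

  evalAll : ∀ {n m} → ℕ → Vec (PR n) m → Vec ℕ n → Maybe (Vec ℕ m)
  evalAll k []       xs = just []
  evalAll k (g ∷ gs) xs =
    eval k g xs >>= λ y → evalAll k gs xs >>= λ ys → just (y ∷ ys)

  search : ∀ {n} → ℕ → PR (suc n) → Vec ℕ n → ℕ → Maybe ℕ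
  search zero    f xs y = nothing
  search (suc k) f xs y = eval k f (y ∷ xs) >>= λ
    { zero    → just y
    ; (suc _) → search k f xs (suc y) }

-- Machines: a (conditional) machine is a partial recursive function of
-- two arguments (program, condition) ↦ output, all strings.

Machine : Set
Machine = PR 2

Runs : Machine → Str → Str → Str → Set
Runs M p x y = ∃ λ k → eval k M (num p ∷ num x ∷ []) ≡ just (num y)

PrefixFree : Machine → Set
PrefixFree M = ∀ x p q y z → Runs M p x y → Runs M (p ++ q) x z → q ≡ []

Simulates : Machine → Machine → Set
Simulates U M = ∃ λ c → ∀ p x y → Runs M p x y →
  ∃ λ q → Runs U q x y × length q ≤ length p + c

Optimal : Machine → Set
Optimal U = ∀ M → Simulates U M

OptimalPF : Machine → Set
OptimalPF V = PrefixFree V × (∀ M → PrefixFree M → Simulates V M)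

IsComplexity : Machine → Str → Str → ℕ → Set
IsComplexity U u v n =
  (∃ λ p → Runs U p v u × length p ≡ n) × (∀ p → Runs U p v u → n ≤ length p)

{-# OPTIONS --safe #-}

-- Upper bound: let p be a shortest V-program for a given n = C(a,b), q a shortest U-program for b
-- given a and n, and d = n - (|p| + |q|). From d (encoded with 2 log d + O(1) bits) and pq one
-- recovers n = |pq| + d, splits pq by running the prefix-free V with condition n, and computes (a,b).
-- Hence d ≤ 2 log d + O(1), so d is bounded.
--
-- Lower bound: given n, enumerate the programs of length n as they halt; there are at most 2^n of
-- them. If the program for (a,b) is the i-th one whose output has first component a, then b is
-- described, given a and n, by the i-th string, of length about log i. Whenever the number of outputs
-- with first component a reaches a power of two 2^l, reserve a codeword of length n - l + O(1) for a.
-- Up to a constant these reservations have total measure Σ 2^(l-n) ≤ 1, because for each a the powers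
-- of two add up to O(number of outputs); so a prefix-free machine realises the codewords, and the two
-- lengths add up to n + O(1).

module Submission where

open import Defs
open import Data.Bool using (false; true)
open import Data.Empty using (⊥-elim)
open import Data.Fin using (Fin; zero; suc)
open import Data.List using ([]; _∷_; _++_; _∷ʳ_; length; reverse)
open import Data.List.Properties using (length-++; reverse-injective; unfold-reverse; reverse-involutive; ++-assoc; ++-identityʳ; ++-cancelˡ; ∷-injective; ∷-injectiveʳ)
open import Data.Maybe using (Maybe; just; _>>=_)
open import Data.Maybe.Properties using (just-injective)
open import Data.Nat
open import Data.Nat.Properties
open import Data.Nat.Solver using (module +-*-Solver)
open import Data.Product using (∃; _×_; _,_; proj₁; proj₂)
open import Data.Sum using (_⊎_; inj₁; inj₂)
open import Data.Vec using (Vec; []; _∷_; head; tail; lookup; map; tabulate)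
open import Data.Vec.Properties using (tabulate-∘; tabulate∘lookup; map-∘; map-id)
open import Function using (_∘_; id)
open import Relation.Binary.Definitions using (tri<; tri≈; tri>)
open import Relation.Binary.PropositionalEquality
open import Relation.Nullary using (yes; no)

-- The machines that the overview describes must exist as programs of the model. `Fn` pairs a total
-- function with a program for it, and a clocked evaluator makes halting of `U` and `V` testable by
-- such functions. Each new machine is an unbounded search for a stage, one number coding a clock
-- and possibly guessed data, that passes a total test. Codewords too are tested, not computed. Such
-- a search may stop at a stage other than the intended one, so the real work is to show that all
-- successful stages agree. This rests on prefix-freeness of `V` for the joint machine, on
-- disjointness of codeword intervals for the machine that yields `a`, and on injectivity of the
-- index within a class for the one that yields `b`. Requests for codewords arrive unsorted, so a
-- free segment need not begin at a multiple of the requested length; a segment of twice that length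
-- always contains an aligned interval. The lower bound thus loses three bits before simulation: one
-- for alignment, one because programs of length `n` are counted by their numbers below `2 ^ suc n`,
-- one between the length of an index and the exponent reserved for it.

private variable
  m n : ℕ

-- Evaluation: monotonicity in the fuel, and fuel-free rules.

>>=-just : ∀ {A B : Set} (x : Maybe A) {f : A → Maybe B} {z} → (x >>= f) ≡ just z →
  ∃ λ y → x ≡ just y × f y ≡ just z
>>=-just (just y) eq = y , refl , eq

mutual
  eval-suc : ∀ k (f : PR n) xs {y} → eval k f xs ≡ just y → eval (suc k) f xs ≡ just y
  eval-suc (suc k) Z xs eq = eq
  eval-suc (suc k) S (x ∷ []) eq = eq
  eval-suc (suc k) (P i) xs eq = eq
  eval-suc (suc k) (Comp f gs) xs eq with >>=-just (evalAll k gs xs) eq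
  ... | ys , eqs , eqf rewrite evalAll-suc k gs xs eqs = eval-suc k f ys eqf
  eval-suc (suc k) (Rec f g) (zero ∷ xs) eq = eval-suc k f xs eq
  eval-suc (suc k) (Rec f g) (suc y ∷ xs) eq with >>=-just (eval k (Rec f g) (y ∷ xs)) eq
  ... | r , eqr , eqg rewrite eval-suc k (Rec f g) (y ∷ xs) eqr = eval-suc k g (y ∷ r ∷ xs) eqg
  eval-suc (suc k) (Mu f) xs eq = search-suc k f xs 0 eq

  evalAll-suc : ∀ k (gs : Vec (PR n) m) xs {ys} → evalAll k gs xs ≡ just ys → evalAll (suc k) gs xs ≡ just ys
  evalAll-suc k [] xs eq = eq
  evalAll-suc k (g ∷ gs) xs eq with >>=-just (eval k g xs) eq
  ... | y , eqg , eq′ with >>=-just (evalAll k gs xs) eq′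
  ... | ys , eqs , eq″ rewrite eval-suc k g xs eqg | evalAll-suc k gs xs eqs = eq″

  search-suc : ∀ k (f : PR (suc n)) xs j {y} → search k f xs j ≡ just y → search (suc k) f xs j ≡ just y
  search-suc (suc k) f xs j eq with >>=-just (eval k f (j ∷ xs)) eq
  ... | zero  , eqf , eq′ rewrite eval-suc k f (j ∷ xs) eqf = eq′
  ... | suc _ , eqf , eq′ rewrite eval-suc k f (j ∷ xs) eqf = search-suc k f xs (suc j) eq′

eval-mono : ∀ {k k′} → k ≤ k′ → (f : PR n) → ∀ xs {y} → eval k f xs ≡ just y → eval k′ f xs ≡ just y
eval-mono {k = k} k≤k′ f xs {y} eq = go (≤⇒≤′ k≤k′)
  where
  go : ∀ {k′} → k ≤′ k′ → eval k′ f xs ≡ just y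
  go ≤′-refl = eq
  go (≤′-step le) = eval-suc _ f xs (go le)

evalAll-mono : ∀ {k k′} → k ≤ k′ → (gs : Vec (PR n) m) → ∀ xs {ys} → evalAll k gs xs ≡ just ys → evalAll k′ gs xs ≡ just ys
evalAll-mono {k = k} k≤k′ gs xs {ys} eq = go (≤⇒≤′ k≤k′)
  where
  go : ∀ {k′} → k ≤′ k′ → evalAll k′ gs xs ≡ just ys
  go ≤′-refl = eq
  go (≤′-step le) = evalAll-suc _ gs xs (go le)

search-mono : ∀ {k k′} → k ≤ k′ → (f : PR (suc n)) → ∀ xs j {y} → search k f xs j ≡ just y → search k′ f xs j ≡ just y
search-mono {k = k} k≤k′ f xs j {y} eq = go (≤⇒≤′ k≤k′)
  where
  go : ∀ {k′} → k ≤′ k′ → search k′ f xs j ≡ just y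
  go ≤′-refl = eq
  go (≤′-step {k′} le) = search-suc k′ f xs j (go le)

infix 4 _⟨_⟩⇓_ _⟨_⟩⇓*_

-- Records rather than functions into Set, so that the program can be inferred from the type.
record _⟨_⟩⇓_ (f : PR n) (xs : Vec ℕ n) (y : ℕ) : Set where
  constructor _,_
  field
    fuel  : ℕ
    halts : eval fuel f xs ≡ just y

record _⟨_⟩⇓*_ (gs : Vec (PR n) m) (xs : Vec ℕ n) (ys : Vec ℕ m) : Set where
  constructor _,_
  field
    fuel  : ℕ
    halts : evalAll fuel gs xs ≡ just ys

⇓-unique : ∀ {f : PR n} {xs y z} → f ⟨ xs ⟩⇓ y → f ⟨ xs ⟩⇓ z → y ≡ z
⇓-unique {f = f} {xs} (k , eq) (l , eq′) = just-injective (trans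
  (sym (eval-mono (m≤m⊔n k l) f xs eq)) (eval-mono (m≤n⊔m k l) f xs eq′))

⇓-[] : ∀ {xs : Vec ℕ n} → [] ⟨ xs ⟩⇓* []
⇓-[] = 0 , refl

⇓-∷ : ∀ {g : PR n} {gs : Vec (PR n) m} {xs y ys} → g ⟨ xs ⟩⇓ y → gs ⟨ xs ⟩⇓* ys → g ∷ gs ⟨ xs ⟩⇓* y ∷ ys
⇓-∷ {g = g} {gs} {xs} {y} {ys} (k , eq) (l , eqs) = k ⊔ l , lemma
  where
  lemma : evalAll (k ⊔ l) (g ∷ gs) xs ≡ just (y ∷ ys)
  lemma rewrite eval-mono (m≤m⊔n k l) g xs eq | evalAll-mono (m≤n⊔m k l) gs xs eqs = refl

⇓-Comp : ∀ {f : PR m} {gs : Vec (PR n) m} {xs ys y} → gs ⟨ xs ⟩⇓* ys → f ⟨ ys ⟩⇓ y → Comp f gs ⟨ xs ⟩⇓ y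
⇓-Comp {f = f} {gs} {xs} {ys} {y} (l , eqs) (k , eq) = suc (k ⊔ l) , lemma
  where
  lemma : eval (suc (k ⊔ l)) (Comp f gs) xs ≡ just y
  lemma rewrite evalAll-mono (m≤n⊔m k l) gs xs eqs = eval-mono (m≤m⊔n k l) f ys eq

⇓-Rec-zero : ∀ {f : PR n} {g xs y} → f ⟨ xs ⟩⇓ y → Rec f g ⟨ 0 ∷ xs ⟩⇓ y
⇓-Rec-zero (k , eq) = suc k , eq

⇓-Rec-suc : ∀ {f : PR n} {g xs i r y} → Rec f g ⟨ i ∷ xs ⟩⇓ r → g ⟨ i ∷ r ∷ xs ⟩⇓ y → Rec f g ⟨ suc i ∷ xs ⟩⇓ y
⇓-Rec-suc {f = f} {g} {xs} {i} {r} {y} (l , eqr) (k , eq) = suc (k ⊔ l) , lemma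
  where
  lemma : eval (suc (k ⊔ l)) (Rec f g) (suc i ∷ xs) ≡ just y
  lemma rewrite eval-mono (m≤n⊔m k l) (Rec f g) (i ∷ xs) eqr = eval-mono (m≤m⊔n k l) g (i ∷ r ∷ xs) eq

-- Fuel pays both for the rounds and for the evaluations inside them. Taking the maximum at every
-- round and one unit more is enough, by monotonicity.
⇓-search : ∀ {f : PR (suc n)} {xs} d j → (∀ i → i < d → ∃ λ v → f ⟨ j + i ∷ xs ⟩⇓ suc v) → f ⟨ j + d ∷ xs ⟩⇓ 0 →
  ∃ λ k → search k f xs j ≡ just (j + d)
⇓-search {f = f} {xs} zero j below (k , eq) rewrite +-identityʳ j = suc k , lemma
  where
  lemma : search (suc k) f xs j ≡ just j
  lemma rewrite eq = refl
⇓-search {f = f} {xs} (suc d) j below at with below 0 z<s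
... | v , (k , eq) rewrite +-identityʳ j | +-suc j d
  with ⇓-search d (suc j)
    (λ i i<d → subst (λ z → ∃ λ v → f ⟨ z ∷ xs ⟩⇓ suc v) (+-suc j i) (below (suc i) (s<s i<d))) at
... | l , eql = suc (k ⊔ l) , lemma
  where
  lemma : search (suc (k ⊔ l)) f xs j ≡ just (suc (j + d))
  lemma rewrite eval-mono (m≤m⊔n k l) f (j ∷ xs) eq = search-mono (m≤n⊔m k l) f xs (suc j) eql

⇓-Mu : ∀ {f : PR (suc n)} {xs y} → (∀ i → i < y → ∃ λ v → f ⟨ i ∷ xs ⟩⇓ suc v) → f ⟨ y ∷ xs ⟩⇓ 0 → Mu f ⟨ xs ⟩⇓ y
⇓-Mu below at with ⇓-search _ 0 below at
... | k , eq = suc k , eq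

search⇒zero : ∀ k (f : PR (suc n)) xs j {y} → search k f xs j ≡ just y → f ⟨ y ∷ xs ⟩⇓ 0
search⇒zero (suc k) f xs j eq with >>=-just (eval k f (j ∷ xs)) eq
... | zero  , eqf , refl = k , eqf
... | suc _ , eqf , eq′ = search⇒zero k f xs (suc j) eq′

⇓-Mu⁻¹ : ∀ {f : PR (suc n)} {xs y} → Mu f ⟨ xs ⟩⇓ y → f ⟨ y ∷ xs ⟩⇓ 0
⇓-Mu⁻¹ {f = f} {xs} (suc k , eq) = search⇒zero k f xs 0 eq

⇓-Comp⁻¹ : ∀ {f : PR m} {gs : Vec (PR n) m} {xs y} → Comp f gs ⟨ xs ⟩⇓ y → ∃ λ ys → gs ⟨ xs ⟩⇓* ys × f ⟨ ys ⟩⇓ y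
⇓-Comp⁻¹ {gs = gs} {xs} (suc k , eq) with >>=-just (evalAll k gs xs) eq
... | ys , eqs , eqf = ys , (k , eqs) , (k , eqf)

⇓-∷⁻¹ : ∀ {g : PR n} {gs : Vec (PR n) m} {xs y ys} → g ∷ gs ⟨ xs ⟩⇓* y ∷ ys → g ⟨ xs ⟩⇓ y × gs ⟨ xs ⟩⇓* ys
⇓-∷⁻¹ {g = g} {gs} {xs} (k , eq) with >>=-just (eval k g xs) eq
... | y , eqg , eq′ with >>=-just (evalAll k gs xs) eq′
... | ys , eqs , refl = (k , eqg) , (k , eqs)

-- Total functions with a program

record Fn (n : ℕ) : Set where
  field
    fun      : Vec ℕ n → ℕ
    code     : PR n
    computes : ∀ xs → code ⟨ xs ⟩⇓ fun xs
open Fn public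

funs : Vec (Fn n) m → Vec ℕ n → Vec ℕ m
funs gs xs = map (λ g → fun g xs) gs

computes* : (gs : Vec (Fn n) m) → ∀ xs → map code gs ⟨ xs ⟩⇓* funs gs xs
computes* []       xs = ⇓-[]
computes* (g ∷ gs) xs = ⇓-∷ (computes g xs) (computes* gs xs)

-- Keeps the program but replaces the function by an equal one in readable form, so that `fun` of a
-- composite reduces to the intended formula and not to nested `natrec`.
ext : (f : Fn n) (g : Vec ℕ n → ℕ) → (∀ xs → fun f xs ≡ g xs) → Fn n
ext f g f≗g = record { fun = g ; code = code f ; computes = λ xs → subst (code f ⟨ xs ⟩⇓_) (f≗g xs) (computes f xs) }

zeroF : Fn n
zeroF = record { fun = λ _ → 0 ; code = Z ; computes = λ xs → 1 , refl }

var : Fin n → Fn n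
var i = record { fun = λ xs → lookup xs i ; code = P i ; computes = λ xs → 1 , refl }

infixl 9 _⊙_
_⊙_ : Fn m → Vec (Fn n) m → Fn n
f ⊙ gs = record
  { fun      = λ xs → fun f (funs gs xs)
  ; code     = Comp (code f) (map code gs)
  ; computes = λ xs → ⇓-Comp (computes* gs xs) (computes f (funs gs xs)) }

sucF : Fn n → Fn n
sucF e = record
  { fun = λ xs → suc (fun e xs) ; code = Comp S (code e ∷ [])
  ; computes = λ xs → ⇓-Comp (⇓-∷ (computes e xs) ⇓-[]) (1 , refl) }

constF : ℕ → Fn n
constF zero    = zeroF
constF (suc c) = sucF (constF c)

natrec : ℕ → (ℕ → ℕ → ℕ) → ℕ → ℕ
natrec z s zero    = z
natrec z s (suc i) = s i (natrec z s i)

recF : Fn n → Fn (suc (suc n)) → Fn (suc n)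
recF {n} z s = record { fun = h ; code = Rec (code z) (code s) ; computes = λ { (y ∷ xs) → go y xs } }
  where
  h : Vec ℕ (suc n) → ℕ
  h (y ∷ xs) = natrec (fun z xs) (λ i r → fun s (i ∷ r ∷ xs)) y
  go : ∀ y xs → Rec (code z) (code s) ⟨ y ∷ xs ⟩⇓ h (y ∷ xs)
  go zero    xs = ⇓-Rec-zero (computes z xs)
  go (suc y) xs = ⇓-Rec-suc (go y xs) (computes s _)

vars : Vec (Fn n) n
vars = tabulate var

tabulate-var : ∀ (xs : Vec ℕ n) (h : Fin m → Fin n) → funs (tabulate (var ∘ h)) xs ≡ tabulate (lookup xs ∘ h)
tabulate-var xs h = sym (tabulate-∘ (λ g → fun g xs) (var ∘ h))

tail² : ∀ (x y : ℕ) (xs : Vec ℕ n) → funs (tabulate (λ i → var (suc (suc i)))) (x ∷ y ∷ xs) ≡ xs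
tail² x y xs = trans (tabulate-var (x ∷ y ∷ xs) (λ i → suc (suc i))) (tabulate∘lookup xs)

vars-id : ∀ (xs : Vec ℕ n) → funs vars xs ≡ xs
vars-id xs = trans (tabulate-var xs id) (tabulate∘lookup xs)

-- The step of a recursion receives the counter and then the running value. `dropSnd` shows a
-- function only the counter (for sums), `dropFst` only the running value (for searches).
dropSnd : Fn (suc n) → Fn (suc (suc n))
dropSnd f = ext (f ⊙ (var zero ∷ tabulate (λ i → var (suc (suc i))))) (λ { (x ∷ y ∷ xs) → fun f (x ∷ xs) })
  λ { (x ∷ y ∷ xs) → cong (λ zs → fun f (x ∷ zs)) (tail² x y xs) }

dropFst : Fn (suc n) → Fn (suc (suc n))
dropFst f = ext (f ⊙ (var (suc zero) ∷ tabulate (λ i → var (suc (suc i))))) (λ { (x ∷ y ∷ xs) → fun f (y ∷ xs) })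
  λ { (x ∷ y ∷ xs) → cong (λ zs → fun f (y ∷ zs)) (tail² x y xs) }

swap : Fn (suc (suc n)) → Fn (suc (suc n))
swap f = ext (f ⊙ (var (suc zero) ∷ var zero ∷ tabulate (λ i → var (suc (suc i))))) (λ { (x ∷ y ∷ xs) → fun f (y ∷ x ∷ xs) })
  λ { (x ∷ y ∷ xs) → cong (λ zs → fun f (y ∷ x ∷ zs)) (tail² x y xs) }

letF : Fn n → Fn (suc n) → Fn n
letF e f = ext (f ⊙ (e ∷ vars)) (λ xs → fun f (fun e xs ∷ xs)) (λ xs → cong (λ ys → fun f (fun e xs ∷ ys)) (vars-id xs))

recE : Fn n → Fn (suc (suc n)) → Fn n → Fn n
recE z s e = letF e (recF z s)

-- Arithmetic, finite sums and bounded search.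

infixl 6 _+F_ _∸F_
infixl 7 _*F_

predF : Fn n → Fn n
predF e = ext (recE zeroF (var zero) e) (λ xs → pred (fun e xs)) (λ xs → lemma (fun e xs))
  where
  lemma : ∀ x → natrec 0 (λ i _ → i) x ≡ pred x
  lemma zero = refl
  lemma (suc x) = refl

_+F_ _∸F_ _*F_ : Fn n → Fn n → Fn n
d +F e = ext (recE d (sucF (var (suc zero))) e) (λ xs → fun d xs + fun e xs) (λ xs → lemma (fun d xs) (fun e xs))
  where
  lemma : ∀ x y → natrec x (λ _ → suc) y ≡ x + y
  lemma x zero    = sym (+-identityʳ x)
  lemma x (suc y) = trans (cong suc (lemma x y)) (sym (+-suc x y))
d ∸F e = ext (recE d (predF (var (suc zero))) e) (λ xs → fun d xs ∸ fun e xs) (λ xs → lemma (fun d xs) (fun e xs))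
  where
  lemma : ∀ x y → natrec x (λ _ → pred) y ≡ x ∸ y
  lemma x zero    = refl
  lemma x (suc y) = trans (cong pred (lemma x y)) (pred[m∸n]≡m∸[1+n] x y)
d *F e = ext (times ⊙ (e ∷ d ∷ [])) (λ xs → fun d xs * fun e xs) (λ xs → lemma (fun d xs) (fun e xs))
  where
  times : Fn 2
  times = recF zeroF (var (suc (suc zero)) +F var (suc zero))
  lemma : ∀ x y → natrec 0 (λ _ r → x + r) y ≡ x * y
  lemma x zero    = sym (*-zeroʳ x)
  lemma x (suc y) = trans (cong (x +_) (lemma x y)) (sym (*-suc x y))

2^F_ : Fn n → Fn n
2^F e = ext (recE (constF 1) (constF 2 *F var (suc zero)) e) (λ xs → 2 ^ fun e xs) (λ xs → lemma (fun e xs))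
  where
  lemma : ∀ x → natrec 1 (λ _ r → 2 * r) x ≡ 2 ^ x
  lemma zero = refl
  lemma (suc x) = cong (2 *_) (lemma x)

ifz : ℕ → ℕ → ℕ → ℕ
ifz zero    x y = x
ifz (suc _) x y = y

ifzF : Fn n → Fn n → Fn n → Fn n
ifzF c d e = ext (recF (var zero) (var (suc (suc (suc zero)))) ⊙ (c ∷ d ∷ e ∷ [])) (λ xs → ifz (fun c xs) (fun d xs) (fun e xs))
  (λ xs → lemma (fun c xs))
  where
  lemma : ∀ c {x y} → natrec x (λ _ _ → y) c ≡ ifz c x y
  lemma zero = refl
  lemma (suc c) = refl

opaque
  dist : ℕ → ℕ → ℕ
  dist x y = (x ∸ y) + (y ∸ x)

  dist-def : ∀ x y → (x ∸ y) + (y ∸ x) ≡ dist x y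
  dist-def x y = refl

  dist-refl : ∀ x → dist x x ≡ 0
  dist-refl x rewrite n∸n≡0 x = refl

  dist≡0 : ∀ x y → dist x y ≡ 0 → x ≡ y
  dist≡0 x y eq = ≤-antisym (m∸n≡0⇒m≤n (m+n≡0⇒m≡0 (x ∸ y) eq)) (m∸n≡0⇒m≤n (m+n≡0⇒n≡0 (x ∸ y) eq))

distF : Fn n → Fn n → Fn n
distF d e = ext ((d ∸F e) +F (e ∸F d)) (λ xs → dist (fun d xs) (fun e xs)) (λ xs → dist-def (fun d xs) (fun e xs))

sum< : ℕ → (ℕ → ℕ) → ℕ
sum< b f = natrec 0 (λ i r → r + f i) b

sumF : Fn n → Fn (suc n) → Fn n
sumF b f = recE zeroF (var (suc zero) +F dropSnd f) b

-- The state r of the iteration stays put once f r = 0, so it never needs to look at the counter.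
least : ℕ → (ℕ → ℕ) → ℕ
least b f = natrec 0 (λ _ r → ifz (f r) r (suc r)) b

leastF : Fn n → Fn (suc n) → Fn n
leastF b f = recE zeroF (ifzF (dropFst f) (var (suc zero)) (sucF (var (suc zero)))) b

least-below : ∀ b f j → j < least b f → f j ≢ 0
least-below (suc b) f j j<l with f (least b f) in eq
... | zero = least-below b f j j<l
... | suc _ with m<1+n⇒m<n∨m≡n j<l
...   | inj₁ j<l′ = least-below b f j j<l′
...   | inj₂ refl = λ fj≡0 → 1+n≢0 (trans (sym eq) fj≡0)

least-stop : ∀ b f → f (least b f) ≡ 0 ⊎ least b f ≡ b
least-stop zero f = inj₂ refl
least-stop (suc b) f with f (least b f) in eq
... | zero = inj₁ eq
... | suc _ with least-stop b f
...   | inj₁ eq′ = ⊥-elim (1+n≢0 (trans (sym eq) eq′))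
...   | inj₂ eq′ = inj₂ (cong suc eq′)

least-≤ : ∀ b f {j} → f j ≡ 0 → least b f ≤ j
least-≤ b f {j} fj≡0 = ≮⇒≥ λ j<l → least-below b f j j<l fj≡0

-- The search never tests `b` itself, but `b` is what it returns when all smaller arguments fail, so
-- a zero at `j = b` is found as well.
least-zero : ∀ b f {j} → j ≤ b → f j ≡ 0 → f (least b f) ≡ 0
least-zero b f {j} j≤b fj≡0 with least-stop b f
... | inj₁ eq = eq
... | inj₂ eq = subst (λ i → f i ≡ 0) (≤-antisym (≤-trans j≤b (≤-reflexive (sym eq))) (least-≤ b f fj≡0)) fj≡0

least-unique : ∀ b f {j} → j ≤ b → f j ≡ 0 → (∀ i → i < j → f i ≢ 0) → least b f ≡ j
least-unique b f {j} j≤b fj≡0 below =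
  ≤-antisym (least-≤ b f fj≡0) (≮⇒≥ λ l<j → below _ l<j (least-zero b f j≤b fj≡0))

-- The clocked evaluator: value 0 for "no result within the clock", suc y for the result y

guard : Vec (Fn n) m → Fn n → Fn n
guard []       e = e
guard (g ∷ gs) e = ifzF g zeroF (guard gs e)

mutual
  -- The clock limits only the length of the searches in `Mu`, since everything else terminates
  -- anyway. It is handed on unchanged to all subcomputations, so it need not agree with the fuel of
  -- `eval`: a result may appear at a smaller clock, but never a wrong one.
  clocked : PR n → Fn (suc n)
  clocked Z           = sucF zeroF
  clocked S           = sucF (sucF (var (suc zero)))
  clocked (P i)       = sucF (var (suc i))
  clocked (Comp f gs) = guard (clocked* gs) (clocked f ⊙ (var zero ∷ map predF (clocked* gs)))
  clocked (Rec f g)   = swap (recF (clocked f) (ifzF (var (suc zero)) zeroF (step g)))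
    where
    step : PR (suc (suc n)) → Fn (suc (suc (suc n)))
    step g = ext (clocked g ⊙ (var (suc (suc zero)) ∷ var zero ∷ predF (var (suc zero)) ∷ tabulate (λ i → var (suc (suc (suc i))))))
      (λ { (i ∷ r ∷ k ∷ xs) → fun (clocked g) (k ∷ i ∷ pred r ∷ xs) })
      λ { (i ∷ r ∷ k ∷ xs) → cong (λ zs → fun (clocked g) (k ∷ i ∷ pred r ∷ zs))
        (trans (tabulate-var (i ∷ r ∷ k ∷ xs) (λ i → suc (suc (suc i)))) (tabulate∘lookup xs)) }
  -- `predF body` vanishes when `f` gives 0 and also when `f` has no result, so the search stops at
  -- whichever comes first. `result` then separates the two, and returns 0 as well if the bound was
  -- reached without either.
  clocked (Mu f)      = letF (leastF (var zero) (predF body)) result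
    where
    body : Fn (suc (suc _))
    body = swap (clocked f)
    result : Fn (suc (suc _))
    result = ifzF body zeroF (ifzF (predF body) (sucF (var zero)) zeroF)

  clocked* : Vec (PR n) m → Vec (Fn (suc n)) m
  clocked* []       = []
  clocked* (g ∷ gs) = clocked g ∷ clocked* gs

ifz-0-suc : ∀ c {e y} → ifz c 0 e ≡ suc y → ∃ λ v → c ≡ suc v × e ≡ suc y
ifz-0-suc (suc v) eq = v , refl , eq

ifz-suc-0 : ∀ c {e y} → ifz c e 0 ≡ suc y → c ≡ 0 × e ≡ suc y
ifz-suc-0 zero eq = refl , eq

guard-suc : ∀ (gs : Vec (Fn n) m) e xs {y} → fun (guard gs e) xs ≡ suc y →
  ∃ λ ys → funs gs xs ≡ map suc ys × fun e xs ≡ suc y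
guard-suc [] e xs eq = [] , refl , eq
guard-suc (g ∷ gs) e xs eq with ifz-0-suc (fun g xs) eq
... | v , eqg , eq′ with guard-suc gs e xs eq′
... | ys , eqs , eqe = v ∷ ys , cong₂ _∷_ eqg eqs , eqe

guard-of-suc : ∀ (gs : Vec (Fn n) m) e xs {ys} → funs gs xs ≡ map suc ys → fun (guard gs e) xs ≡ fun e xs
guard-of-suc [] e xs eqs = refl
guard-of-suc (g ∷ gs) e xs {y ∷ ys} eqs with fun g xs | eqs
... | suc _ | eqs′ = guard-of-suc gs e xs (cong tail eqs′)

funs-pred : ∀ (gs : Vec (Fn n) m) xs {ys} → funs gs xs ≡ map suc ys → funs (map predF gs) xs ≡ ys
funs-pred gs xs {ys} eqs = begin
  funs (map predF gs) xs             ≡⟨ map-∘ _ _ gs ⟨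
  map (λ g → pred (fun g xs)) gs     ≡⟨ map-∘ _ _ gs ⟩
  map pred (funs gs xs)              ≡⟨ cong (map pred) eqs ⟩
  map pred (map suc ys)              ≡⟨ map-∘ _ _ ys ⟨
  map id ys                          ≡⟨ map-id ys ⟩
  ys                                 ∎
  where open ≡-Reasoning

mutual
  clocked-sound : ∀ (f : PR n) k xs {y} → fun (clocked f) (k ∷ xs) ≡ suc y → f ⟨ xs ⟩⇓ y
  clocked-sound Z k xs refl = 1 , refl
  clocked-sound S k (x ∷ []) refl = 1 , refl
  clocked-sound (P i) k xs refl = 1 , refl
  clocked-sound (Comp f gs) k xs eq with guard-suc (clocked* gs) (clocked f ⊙ (var zero ∷ map predF (clocked* gs))) (k ∷ xs) eq
  ... | ys , eqs , eqf = ⇓-Comp (clocked*-sound gs k xs eqs)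
    (clocked-sound f k ys (trans (cong (λ zs → fun (clocked f) (k ∷ zs)) (sym (funs-pred (clocked* gs) (k ∷ xs) eqs))) eqf))
  clocked-sound (Rec f g) k (i ∷ xs) eq = go i eq
    where
    go : ∀ i {y} → fun (clocked (Rec f g)) (k ∷ i ∷ xs) ≡ suc y → Rec f g ⟨ i ∷ xs ⟩⇓ y
    go zero eq = ⇓-Rec-zero (clocked-sound f k xs eq)
    go (suc i) eq with ifz-0-suc (fun (clocked (Rec f g)) (k ∷ i ∷ xs)) eq
    ... | r , eqr , eqg = ⇓-Rec-suc (go i eqr)
      (clocked-sound g k (i ∷ r ∷ xs) (trans (cong (λ z → fun (clocked g) (k ∷ i ∷ pred z ∷ xs)) (sym eqr)) eqg))
  clocked-sound (Mu f) k xs eq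
    with ifz-0-suc (fun (clocked f) (k ∷ least k (λ i → pred (fun (clocked f) (k ∷ i ∷ xs))) ∷ xs)) eq
  ... | v , eqv , eq′ with ifz-suc-0 (pred (fun (clocked f) (k ∷ least k (λ i → pred (fun (clocked f) (k ∷ i ∷ xs))) ∷ xs))) eq′
  ... | eqp , refl = ⇓-Mu below (clocked-sound f k _ (trans eqv (cong suc (trans (sym (cong pred eqv)) eqp))))
    where
    below : ∀ i → i < least k (λ i → pred (fun (clocked f) (k ∷ i ∷ xs))) → ∃ λ v → f ⟨ i ∷ xs ⟩⇓ suc v
    below i i<l with fun (clocked f) (k ∷ i ∷ xs) in eqi | least-below k (λ i → pred (fun (clocked f) (k ∷ i ∷ xs))) i i<l
    ... | zero        | ne = ⊥-elim (ne refl)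
    ... | suc zero    | ne = ⊥-elim (ne refl)
    ... | suc (suc v) | ne = v , clocked-sound f k (i ∷ xs) eqi

  clocked*-sound : ∀ (gs : Vec (PR n) m) k xs {ys} → funs (clocked* gs) (k ∷ xs) ≡ map suc ys → gs ⟨ xs ⟩⇓* ys
  clocked*-sound [] k xs {[]} eq = ⇓-[]
  clocked*-sound (g ∷ gs) k xs {y ∷ ys} eq =
    ⇓-∷ (clocked-sound g k xs (cong head eq)) (clocked*-sound gs k xs (cong tail eq))

mutual
  clocked-complete : ∀ k (f : PR n) xs {y} → eval k f xs ≡ just y → ∀ k′ → k ≤ k′ → fun (clocked f) (k′ ∷ xs) ≡ suc y
  clocked-complete (suc k) Z xs refl k′ le = refl
  clocked-complete (suc k) S (x ∷ []) refl k′ le = refl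
  clocked-complete (suc k) (P i) xs refl k′ le = refl
  clocked-complete (suc k) (Comp f gs) xs eq k′ le with >>=-just (evalAll k gs xs) eq
  ... | ys , eqs , eqf = begin
    fun (clocked (Comp f gs)) (k′ ∷ xs)                                ≡⟨ guard-of-suc (clocked* gs) _ (k′ ∷ xs) vals ⟩
    fun (clocked f) (k′ ∷ funs (map predF (clocked* gs)) (k′ ∷ xs))
      ≡⟨ cong (λ zs → fun (clocked f) (k′ ∷ zs)) (funs-pred (clocked* gs) (k′ ∷ xs) vals) ⟩
    fun (clocked f) (k′ ∷ ys)                                          ≡⟨ clocked-complete k f ys eqf k′ (<⇒≤ le) ⟩
    suc _                                                              ∎
    where
    open ≡-Reasoning
    vals = clocked*-complete k gs xs eqs k′ (<⇒≤ le)
  clocked-complete (suc k) (Rec f g) (zero ∷ xs) eq k′ le = clocked-complete k f xs eq k′ (<⇒≤ le)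
  clocked-complete (suc k) (Rec f g) (suc i ∷ xs) eq k′ le with >>=-just (eval k (Rec f g) (i ∷ xs)) eq
  ... | r , eqr , eqg = begin
    h (fun (clocked (Rec f g)) (k′ ∷ i ∷ xs))   ≡⟨ cong h (clocked-complete k (Rec f g) (i ∷ xs) eqr k′ (<⇒≤ le)) ⟩
    h (suc r)                                   ≡⟨ clocked-complete k g (i ∷ r ∷ xs) eqg k′ (<⇒≤ le) ⟩
    suc _                                       ∎
    where
    open ≡-Reasoning
    h : ℕ → ℕ
    h z = ifz z 0 (fun (clocked g) (k′ ∷ i ∷ pred z ∷ xs))
  clocked-complete (suc k) (Mu f) xs {y} eq k′ le with search-complete k f xs 0 eq k′ (<⇒≤ le)
  ... | y≤k , at , below = begin
    h (least k′ (λ i → pred (fun (clocked f) (k′ ∷ i ∷ xs))))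
      ≡⟨ cong h (least-unique k′ _ (≤-trans y≤k (<⇒≤ le)) (cong pred at) (λ i i<y → subst (λ z → pred z ≢ 0) (sym (proj₂ (below i z≤n i<y))) λ ())) ⟩
    h y ≡⟨ cong (λ z → ifz z 0 (ifz (pred z) (suc y) 0)) at ⟩
    suc y ∎
    where
    open ≡-Reasoning
    h : ℕ → ℕ
    h i = ifz (fun (clocked f) (k′ ∷ i ∷ xs)) 0 (ifz (pred (fun (clocked f) (k′ ∷ i ∷ xs))) (suc i) 0)

  clocked*-complete : ∀ k (gs : Vec (PR n) m) xs {ys} → evalAll k gs xs ≡ just ys → ∀ k′ → k ≤ k′ →
    funs (clocked* gs) (k′ ∷ xs) ≡ map suc ys
  clocked*-complete k [] xs refl k′ le = refl
  clocked*-complete k (g ∷ gs) xs eq k′ le with >>=-just (eval k g xs) eq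
  ... | y , eqg , eq′ with >>=-just (evalAll k gs xs) eq′
  ... | ys , eqs , refl = cong₂ _∷_ (clocked-complete k g xs eqg k′ le) (clocked*-complete k gs xs eqs k′ le)

  -- Each round costs a unit of fuel, whence `y ≤ j + k`; this is what puts the result within reach
  -- of the bounded search in `clocked`.
  search-complete : ∀ k (f : PR (suc n)) xs j {y} → search k f xs j ≡ just y → ∀ k′ → k ≤ k′ →
    y ≤ j + k × fun (clocked f) (k′ ∷ y ∷ xs) ≡ 1 ×
    (∀ i → j ≤ i → i < y → ∃ λ v → fun (clocked f) (k′ ∷ i ∷ xs) ≡ suc (suc v))
  search-complete (suc k) f xs j eq k′ le with >>=-just (eval k f (j ∷ xs)) eq
  ... | zero  , eqf , refl = m≤m+n j (suc k) , clocked-complete k f (j ∷ xs) eqf k′ (<⇒≤ le) , λ i j≤i i<j → ⊥-elim (≤⇒≯ j≤i i<j)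
  ... | suc v , eqf , eq′ with search-complete k f xs (suc j) eq′ k′ (<⇒≤ le)
  ... | y≤ , at , below = ≤-trans y≤ (≤-reflexive (sym (+-suc j k))) , at , below′
    where
    below′ : ∀ i → j ≤ i → i < _ → ∃ λ v → fun (clocked f) (k′ ∷ i ∷ xs) ≡ suc (suc v)
    below′ i j≤i i<y with m≤n⇒m<n∨m≡n j≤i
    ... | inj₁ j<i  = below i j<i i<y
    ... | inj₂ refl = v , clocked-complete k f (j ∷ xs) eqf k′ (<⇒≤ le)

-- Unbounded search over stages.

-- `φ` reports 0 for failure at a stage and `suc y` for the output `y`; the inner `Mu` looks for the
-- first success. All machines built below have this shape.
searcher : Fn (suc n) → PR n
searcher φ = Comp (code (predF φ)) (Mu (code (ifzF φ (sucF zeroF) zeroF)) ∷ map code vars)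

searcher-halts : ∀ (φ : Fn (suc n)) xs {t y} → fun φ (t ∷ xs) ≡ suc y →
  ∃ λ t′ → ∃ λ y′ → fun φ (t′ ∷ xs) ≡ suc y′ × searcher φ ⟨ xs ⟩⇓ y′
searcher-halts φ xs {t} {y} eq = go (fun φ (t′ ∷ xs)) refl
  where
  stop : ℕ → ℕ
  stop i = ifz (fun φ (i ∷ xs)) 1 0
  t′ = least t stop
  stop-t′ : stop t′ ≡ 0
  stop-t′ = least-zero t stop ≤-refl (cong (λ z → ifz z 1 0) eq)
  below : ∀ i → i < t′ → ∃ λ v → code (ifzF φ (sucF zeroF) zeroF) ⟨ i ∷ xs ⟩⇓ suc v
  below i i<t′ with fun φ (i ∷ xs) | least-below t stop i i<t′ | computes (ifzF φ (sucF zeroF) zeroF) (i ∷ xs)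
  ... | zero  | ne | c = 0 , c
  ... | suc _ | ne | c = ⊥-elim (ne refl)
  go : ∀ v → fun φ (t′ ∷ xs) ≡ v → ∃ λ t′ → ∃ λ y′ → fun φ (t′ ∷ xs) ≡ suc y′ × searcher φ ⟨ xs ⟩⇓ y′
  go zero eq′ = ⊥-elim (1+n≢0 (trans (cong (λ z → ifz z 1 0) (sym eq′)) stop-t′))
  go (suc y′) eq′ = t′ , y′ , eq′ , ⇓-Comp
    (⇓-∷ (⇓-Mu below (subst (code (ifzF φ (sucF zeroF) zeroF) ⟨ t′ ∷ xs ⟩⇓_) stop-t′ (computes (ifzF φ (sucF zeroF) zeroF) (t′ ∷ xs))))
         (subst (map code vars ⟨ xs ⟩⇓*_) (vars-id xs) (computes* vars xs)))
    (subst (code (predF φ) ⟨ t′ ∷ xs ⟩⇓_) (cong pred eq′) (computes (predF φ) (t′ ∷ xs)))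

-- The stage exhibited need not be the first successful one, hence the demand that every success
-- yields the same output.
searcher-computes : ∀ (φ : Fn (suc n)) xs {t y} → fun φ (t ∷ xs) ≡ suc y → (∀ u {z} → fun φ (u ∷ xs) ≡ suc z → z ≡ y) →
  searcher φ ⟨ xs ⟩⇓ y
searcher-computes φ xs found unique with searcher-halts φ xs found
... | u , z , eq , halt = subst (searcher φ ⟨ xs ⟩⇓_) (unique u eq) halt

⇓*-unique : ∀ {gs : Vec (PR n) m} {xs ys zs} → gs ⟨ xs ⟩⇓* ys → gs ⟨ xs ⟩⇓* zs → ys ≡ zs
⇓*-unique {gs = gs} {xs} (k , eq) (l , eq′) = just-injective (trans
  (sym (evalAll-mono (m≤m⊔n k l) gs xs eq)) (evalAll-mono (m≤n⊔m k l) gs xs eq′))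

searcher-finds : ∀ (φ : Fn (suc n)) xs {y} → searcher φ ⟨ xs ⟩⇓ y → ∃ λ t → fun φ (t ∷ xs) ≡ suc y
searcher-finds φ xs run with ⇓-Comp⁻¹ run
... | t ∷ ys , runs , out with ⇓-∷⁻¹ runs
... | μ , runs′ with ⇓*-unique runs′ (computes* vars xs)
... | refl rewrite vars-id xs
  with fun φ (t ∷ xs) in eqφ | ⇓-unique (⇓-Mu⁻¹ μ) (computes (ifzF φ (sucF zeroF) zeroF) (t ∷ xs))
     | ⇓-unique out (computes (predF φ) (t ∷ xs))
... | suc v | _ | refl = t , eqφ

-- The numbering of strings

-- The binary value of the string with a 1 put in front. Strings of length `l` fill the interval
-- from `2 ^ l` to `2 ^ suc l`, and the extensions of `s` by `j` bits fill the dyadic interval of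
-- length `2 ^ j` that begins at `N s * 2 ^ j`.
N : Str → ℕ
N = numFrom 1

2*-bit : ∀ a b → a ≤ 2 * a + bit b
2*-bit a b = ≤-trans (m≤m+n a (a + 0)) (m≤m+n (2 * a) (bit b))

numFrom-≥ : ∀ acc s → acc ≤ numFrom acc s
numFrom-≥ acc []       = ≤-refl
numFrom-≥ acc (b ∷ s) = ≤-trans (2*-bit acc b) (numFrom-≥ (2 * acc + bit b) s)

suc-num : ∀ s → suc (num s) ≡ N s
suc-num s = m+[n∸m]≡n (numFrom-≥ 1 s)

numFrom-++ : ∀ acc s t → numFrom acc (s ++ t) ≡ numFrom (numFrom acc s) t
numFrom-++ acc []       t = refl
numFrom-++ acc (b ∷ s) t = numFrom-++ (2 * acc + bit b) s t

numL : Str → ℕ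
numL []       = 1
numL (b ∷ s) = 2 * numL s + bit b

N-reverse : ∀ s → N (reverse s) ≡ numL s
N-reverse [] = refl
N-reverse (b ∷ s) = begin
  N (reverse (b ∷ s))              ≡⟨ cong N (unfold-reverse b s) ⟩
  N (reverse s ∷ʳ b)               ≡⟨ numFrom-++ 1 (reverse s) (b ∷ []) ⟩
  2 * N (reverse s) + bit b        ≡⟨ cong (λ z → 2 * z + bit b) (N-reverse s) ⟩
  2 * numL s + bit b               ∎
  where open ≡-Reasoning

numL-incL : ∀ s → numL (incL s) ≡ suc (numL s)
numL-incL []           = refl
numL-incL (false ∷ s) = +-suc (2 * numL s) 0
numL-incL (true ∷ s) rewrite numL-incL s = solve 1 (λ x → con 2 :* (con 1 :+ x) :+ con 0 := con 1 :+ (con 2 :* x :+ con 1)) refl (numL s)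
  where open +-*-Solver

numL-strL : ∀ x → numL (strL x) ≡ suc x
numL-strL zero    = refl
numL-strL (suc x) = trans (numL-incL (strL x)) (cong suc (numL-strL x))

num-str : ∀ x → num (str x) ≡ x
num-str x = cong (_∸ 1) (trans (N-reverse (strL x)) (numL-strL x))

numL-positive : ∀ s → 1 ≤ numL s
numL-positive []       = ≤-refl
numL-positive (b ∷ s) = ≤-trans (numL-positive s) (2*-bit (numL s) b)

bit-injective : ∀ x y b c → 2 * x + bit b ≡ 2 * y + bit c → x ≡ y × b ≡ c
bit-injective x y false false eq = *-cancelˡ-≡ x y 2 (+-cancelʳ-≡ 0 (2 * x) (2 * y) eq) , refl
bit-injective x y true  true  eq = *-cancelˡ-≡ x y 2 (+-cancelʳ-≡ 1 (2 * x) (2 * y) eq) , refl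
bit-injective x y false true  eq = ⊥-elim (even≢odd x y (trans (sym (+-identityʳ (2 * x))) (trans eq (+-comm (2 * y) 1))))
bit-injective x y true  false eq = ⊥-elim (even≢odd y x (trans (sym (+-identityʳ (2 * y))) (trans (sym eq) (+-comm (2 * x) 1))))

1≢2*+bit : ∀ x b → 1 ≤ x → 1 ≢ 2 * x + bit b
1≢2*+bit (suc x) b _ eq = 1+n≢0 (trans (sym (+-suc x (x + 0))) (m+n≡0⇒m≡0 (x + suc (x + 0)) (sym (suc-injective eq))))

numL-injective : ∀ s t → numL s ≡ numL t → s ≡ t
numL-injective []       []       eq = refl
numL-injective []       (b ∷ t) eq = ⊥-elim (1≢2*+bit (numL t) b (numL-positive t) eq)
numL-injective (b ∷ s) []       eq = ⊥-elim (1≢2*+bit (numL s) b (numL-positive s) (sym eq))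
numL-injective (b ∷ s) (c ∷ t) eq with bit-injective (numL s) (numL t) b c eq
... | eqs , refl = cong (b ∷_) (numL-injective s t eqs)

num-injective : ∀ s t → num s ≡ num t → s ≡ t
num-injective s t eq = reverse-injective (numL-injective (reverse s) (reverse t)
  (trans (N-num s) (trans (cong suc eq) (sym (N-num t)))))
  where
  N-num : ∀ s → numL (reverse s) ≡ suc (num s)
  N-num s = trans (sym (N-reverse (reverse s))) (trans (cong N (reverse-involutive s)) (sym (suc-num s)))

str-num : ∀ s → str (num s) ≡ s
str-num s = num-injective (str (num s)) s (num-str (num s))

N-str : ∀ x → N (str x) ≡ suc x
N-str x = trans (sym (suc-num (str x))) (cong suc (num-str x))

numFrom-lower : ∀ acc s → acc * 2 ^ length s ≤ numFrom acc s
numFrom-lower acc []       = ≤-reflexive (*-identityʳ acc)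
numFrom-lower acc (b ∷ s) = ≤-trans (begin
  acc * (2 * 2 ^ length s)              ≡⟨ *-assoc acc 2 (2 ^ length s) ⟨
  acc * 2 * 2 ^ length s                ≡⟨ cong (_* 2 ^ length s) (*-comm acc 2) ⟩
  2 * acc * 2 ^ length s                ≤⟨ *-monoˡ-≤ (2 ^ length s) (m≤m+n (2 * acc) (bit b)) ⟩
  (2 * acc + bit b) * 2 ^ length s      ∎) (numFrom-lower (2 * acc + bit b) s)
  where open ≤-Reasoning

bit≤1 : ∀ b → bit b ≤ 1
bit≤1 false = z≤n
bit≤1 true  = ≤-refl

numFrom-upper : ∀ acc s → numFrom acc s < suc acc * 2 ^ length s
numFrom-upper acc []       = ≤-reflexive (sym (*-identityʳ (suc acc)))
numFrom-upper acc (b ∷ s) = <-≤-trans (numFrom-upper (2 * acc + bit b) s) (begin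
  suc (2 * acc + bit b) * 2 ^ length s    ≤⟨ *-monoˡ-≤ (2 ^ length s) (s≤s (+-monoʳ-≤ (2 * acc) (bit≤1 b))) ⟩
  suc (2 * acc + 1) * 2 ^ length s
    ≡⟨ solve 2 (λ a p → (con 1 :+ (con 2 :* a :+ con 1)) :* p := (con 1 :+ a) :* (con 2 :* p)) refl acc (2 ^ length s) ⟩
  suc acc * (2 * 2 ^ length s)            ∎)
  where
  open ≤-Reasoning
  open +-*-Solver

N-lower : ∀ s → 2 ^ length s ≤ N s
N-lower s = ≤-trans (≤-reflexive (sym (*-identityˡ _))) (numFrom-lower 1 s)

N-upper : ∀ s → N s < 2 ^ suc (length s)
N-upper s = numFrom-upper 1 s

-- `numFrom` is affine in the accumulator with slope `2 ^ length s`; comparing with accumulator 1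
-- avoids subtraction. The induction hypothesis is used twice, because `N (b ∷ s)` itself continues
-- with accumulator `2 + bit b`; the cancelled summand makes room for the second use.
numFrom-linear : ∀ acc s → numFrom acc s + 2 ^ length s ≡ acc * 2 ^ length s + N s
numFrom-linear acc []       = cong (_+ 1) (sym (*-identityʳ acc))
numFrom-linear acc (b ∷ s) = +-cancelʳ-≡ ((2 + bit b) * p) _ _ (begin
  (x + 2 * p) + (2 + bit b) * p
    ≡⟨ solve 3 (λ x p d → (x :+ con 2 :* p) :+ (con 2 :+ d) :* p := (x :+ p) :+ (con 3 :+ d) :* p) refl x p (bit b) ⟩
  (x + p) + (3 + bit b) * p
    ≡⟨ cong (_+ (3 + bit b) * p) (numFrom-linear (2 * acc + bit b) s) ⟩
  ((2 * acc + bit b) * p + N s) + (3 + bit b) * p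
    ≡⟨ solve 4 (λ a p d z → ((con 2 :* a :+ d) :* p :+ z) :+ (con 3 :+ d) :* p := a :* (con 2 :* p) :+ ((con 2 :+ d) :* p :+ z) :+ (con 1 :+ d) :* p) refl acc p (bit b) (N s) ⟩
  acc * (2 * p) + ((2 + bit b) * p + N s) + (1 + bit b) * p
    ≡⟨ cong (λ z → acc * (2 * p) + z + (1 + bit b) * p) (numFrom-linear (2 + bit b) s) ⟨
  acc * (2 * p) + (N (b ∷ s) + p) + (1 + bit b) * p
    ≡⟨ solve 4 (λ a p d z → a :* (con 2 :* p) :+ (z :+ p) :+ (con 1 :+ d) :* p := (a :* (con 2 :* p) :+ z) :+ (con 2 :+ d) :* p) refl acc p (bit b) (N (b ∷ s)) ⟩
  (acc * (2 * p) + N (b ∷ s)) + (2 + bit b) * p        ∎)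
  where
  open ≡-Reasoning
  open +-*-Solver
  p = 2 ^ length s
  x = numFrom (2 * acc + bit b) s

N-++ : ∀ s t → N (s ++ t) + 2 ^ length t ≡ N s * 2 ^ length t + N t
N-++ s t = trans (cong (_+ 2 ^ length t) (numFrom-++ 1 s t)) (numFrom-linear (N s) t)

2^-cancel-< : ∀ a b → 2 ^ a < 2 ^ b → a < b
2^-cancel-< a b lt = ≰⇒> λ b≤a → <⇒≱ lt (^-monoʳ-≤ 2 b≤a)

opaque
  len : ℕ → ℕ
  len x = length (str x)

  length-str : ∀ x → length (str x) ≡ len x
  length-str x = refl

  len-num : ∀ s → len (num s) ≡ length s
  len-num s = cong length (str-num s)

  len-lower : ∀ x → 2 ^ len x ≤ suc x
  len-lower x = ≤-trans (N-lower (str x)) (≤-reflexive (N-str x))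

  len-upper : ∀ x → suc x < 2 ^ suc (len x)
  len-upper x = ≤-trans (s≤s (≤-reflexive (sym (N-str x)))) (N-upper (str x))

n<2^n : ∀ x → x < 2 ^ x
n<2^n zero    = ≤-refl
n<2^n (suc x) = ≤-trans (+-mono-≤ (m^n>0 2 x) (n<2^n x)) (+-monoʳ-≤ (2 ^ x) (m≤m+n (2 ^ x) 0))

len-≤ : ∀ x → len x ≤ x
len-≤ x = s≤s⁻¹ (≤-trans (n<2^n (len x)) (len-lower x))

-- String operations as total recursive functions

lenF : Fn n → Fn n
lenF e = ext (body ⊙ (e ∷ [])) (λ xs → len (fun e xs)) (λ xs → lemma (fun e xs))
  where
  body : Fn 1
  body = leastF (var zero) (sucF (sucF (var (suc zero))) ∸F 2^F sucF (var zero))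
  lemma : ∀ x → least x (λ r → (2 + x) ∸ 2 ^ suc r) ≡ len x
  lemma x = least-unique x _ (len-≤ x) (m≤n⇒m∸n≡0 (len-upper x)) λ i i<l eq →
    <-irrefl refl (≤-trans (m∸n≡0⇒m≤n eq) (≤-trans (^-monoʳ-≤ 2 i<l) (len-lower x)))

opaque
  unfolding len

  cat : ℕ → ℕ → ℕ
  cat x y = num (str x ++ str y)

  cat-num : ∀ s t → cat (num s) (num t) ≡ num (s ++ t)
  cat-num s t = cong₂ (λ x y → num (x ++ y)) (str-num s) (str-num t)

  cat-injective : ∀ x y s → cat x y ≡ num s → str x ++ str y ≡ s
  cat-injective x y s = num-injective (str x ++ str y) s

  cat-arith : ∀ x y → (suc x * 2 ^ len y + suc y) ∸ suc (2 ^ len y) ≡ cat x y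
  cat-arith x y = begin
    (suc x * 2 ^ len y + suc y) ∸ suc (2 ^ len y)
      ≡⟨ cong₂ (λ a b → (a * 2 ^ len y + b) ∸ suc (2 ^ len y)) (N-str x) (N-str y) ⟨
    (N (str x) * 2 ^ len y + N (str y)) ∸ suc (2 ^ len y)      ≡⟨ cong (_∸ suc (2 ^ len y)) (N-++ (str x) (str y)) ⟨
    (N (str x ++ str y) + 2 ^ len y) ∸ suc (2 ^ len y)
      ≡⟨ cong (λ z → (z + 2 ^ len y) ∸ suc (2 ^ len y)) (suc-num (str x ++ str y)) ⟨
    (cat x y + 2 ^ len y) ∸ 2 ^ len y                          ≡⟨ m+n∸n≡m (cat x y) (2 ^ len y) ⟩
    cat x y                                                    ∎
    where open ≡-Reasoning

catF : Fn n → Fn n → Fn n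
catF d e = ext ((sucF d *F 2^F lenF e +F sucF e) ∸F sucF (2^F lenF e))
  (λ xs → cat (fun d xs) (fun e xs)) (λ xs → cat-arith (fun d xs) (fun e xs))

-- The integer part of `x / 2 ^ j`. Applied to a value of `N` it deletes the last `j` bits.
quo : ℕ → ℕ → ℕ
quo x j = least x (λ h → suc x ∸ suc h * 2 ^ j)

quoF : Fn n → Fn n → Fn n
quoF d e = ext (body ⊙ (d ∷ e ∷ [])) (λ xs → quo (fun d xs) (fun e xs)) (λ xs → refl)
  where
  body : Fn 2
  body = leastF (var zero) (sucF (var (suc zero)) ∸F sucF (var zero) *F 2^F var (suc (suc zero)))

quo-++ : ∀ s t → quo (N (s ++ t)) (length t) ≡ N s
quo-++ s t = least-unique _ _ N≤ (m≤n⇒m∸n≡0 upper) λ i i<N eq →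
    <-irrefl refl (≤-trans (m∸n≡0⇒m≤n eq) (≤-trans (*-monoˡ-≤ (2 ^ length t) i<N) lower))
  where
  lower : N s * 2 ^ length t ≤ N (s ++ t)
  lower rewrite numFrom-++ 1 s t = numFrom-lower (N s) t
  upper : N (s ++ t) < suc (N s) * 2 ^ length t
  upper rewrite numFrom-++ 1 s t = numFrom-upper (N s) t
  N≤ : N s ≤ N (s ++ t)
  N≤ rewrite numFrom-++ 1 s t = numFrom-≥ (N s) t

lowBit : ℕ → ℕ
lowBit x = x ∸ 2 * quo x 1

lowBit-N : ∀ s b → lowBit (N (s ∷ʳ b)) ≡ bit b
lowBit-N s b rewrite quo-++ s (b ∷ []) | numFrom-++ 1 s (b ∷ []) = m+n∸m≡n (2 * N s) (bit b)

dbl-∷ʳ : ∀ s b → dbl (s ∷ʳ b) ≡ dbl s ++ (b ∷ b ∷ [])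
dbl-∷ʳ [] b = refl
dbl-∷ʳ (c ∷ s) b = cong (λ z → c ∷ c ∷ z) (dbl-∷ʳ s b)

N-dbl-∷ʳ : ∀ s b → N (dbl (s ∷ʳ b)) ≡ 4 * N (dbl s) + 3 * bit b
N-dbl-∷ʳ s b rewrite dbl-∷ʳ s b | numFrom-++ 1 (dbl s) (b ∷ b ∷ []) =
  solve 2 (λ x d → con 2 :* (con 2 :* x :+ d) :+ d := con 4 :* x :+ con 3 :* d) refl (N (dbl s)) (bit b)
  where open +-*-Solver

-- dblPrefix x i = N (dbl (take i (str x))): the prefix of length suc i is read off as a quotient of suc x.
dblPrefix : ℕ → ℕ → ℕ
dblPrefix x i = natrec 1 (λ i r → 4 * r + 3 * lowBit (quo (suc x) (len x ∸ suc i))) i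

-- Induction on `q`, moving its bits one at a time to the processed prefix `p`. The next bit is the
-- last bit of the longer prefix.
dblPrefix-++ : ∀ p q r → dblPrefix (num ((p ++ q) ++ r)) (length p) ≡ N (dbl p) →
  dblPrefix (num ((p ++ q) ++ r)) (length (p ++ q)) ≡ N (dbl (p ++ q))
dblPrefix-++ p [] r eq rewrite ++-identityʳ p = eq
dblPrefix-++ p (b ∷ q) r eq rewrite sym (++-assoc p (b ∷ []) q) = dblPrefix-++ (p ∷ʳ b) q r (begin
  dblPrefix x (length (p ∷ʳ b))                                                    ≡⟨ cong (dblPrefix x) len-∷ʳ ⟩
  4 * dblPrefix x (length p) + 3 * lowBit (quo (suc x) (len x ∸ suc (length p)))
    ≡⟨ cong₂ (λ y z → 4 * y + 3 * lowBit z) eq quotient ⟩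
  4 * N (dbl p) + 3 * lowBit (N (p ∷ʳ b))
    ≡⟨ cong (λ z → 4 * N (dbl p) + 3 * z) (lowBit-N p b) ⟩
  4 * N (dbl p) + 3 * bit b                                                        ≡⟨ N-dbl-∷ʳ p b ⟨
  N (dbl (p ∷ʳ b))                                                                 ∎)
  where
  open ≡-Reasoning
  s = ((p ∷ʳ b) ++ q) ++ r
  x = num s
  len-∷ʳ : length (p ∷ʳ b) ≡ suc (length p)
  len-∷ʳ = trans (length-++ p) (+-comm (length p) 1)
  rest : len x ∸ suc (length p) ≡ length (q ++ r)
  rest = begin
    len x ∸ suc (length p)
      ≡⟨ cong₂ _∸_ (trans (len-num s) (cong length (++-assoc (p ∷ʳ b) q r))) (sym len-∷ʳ) ⟩
    length ((p ∷ʳ b) ++ (q ++ r)) ∸ length (p ∷ʳ b)              ≡⟨ cong (_∸ length (p ∷ʳ b)) (length-++ (p ∷ʳ b)) ⟩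
    length (p ∷ʳ b) + length (q ++ r) ∸ length (p ∷ʳ b)          ≡⟨ m+n∸m≡n (length (p ∷ʳ b)) _ ⟩
    length (q ++ r)                                              ∎
  quotient : quo (suc x) (len x ∸ suc (length p)) ≡ N (p ∷ʳ b)
  quotient = trans (cong₂ quo (trans (suc-num s) (cong N (++-assoc (p ∷ʳ b) q r))) rest) (quo-++ (p ∷ʳ b) (q ++ r))

dblF : Fn n → Fn n
dblF e = ext (body ⊙ (e ∷ [])) (λ xs → num (dbl (str (fun e xs)))) (λ xs → lemma (fun e xs))
  where
  q : Fn 3
  q = quoF (sucF (var (suc (suc zero)))) (lenF (var (suc (suc zero))) ∸F sucF (var zero))
  body : Fn 1
  body = predF (recE (constF 1) (constF 4 *F var (suc zero) +F constF 3 *F (q ∸F constF 2 *F quoF q (constF 1))) (lenF (var zero)))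
  lemma : ∀ x → pred (dblPrefix x (len x)) ≡ num (dbl (str x))
  lemma x = cong pred (begin
    dblPrefix x (len x)
      ≡⟨ cong (λ z → dblPrefix z (len x)) (trans (cong num (++-identityʳ (str x))) (num-str x)) ⟨
    dblPrefix (num (str x ++ [])) (len x)           ≡⟨ cong (dblPrefix _) (sym (length-str x)) ⟩
    dblPrefix (num (str x ++ [])) (length (str x))  ≡⟨ dblPrefix-++ [] (str x) [] refl ⟩
    N (dbl (str x))                                ∎)
    where open ≡-Reasoning

-- Pairing of numbers and its inverses.

pair-injective : ∀ a b a′ b′ → pair a b ≡ pair a′ b′ → a ≡ a′ × b ≡ b′
pair-injective [] b [] b′ eq = refl , ∷-injectiveʳ (∷-injectiveʳ eq)
pair-injective [] b (false ∷ a′) b′ ()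
pair-injective [] b (true ∷ a′) b′ ()
pair-injective (false ∷ a) b [] b′ ()
pair-injective (true ∷ a) b [] b′ ()
pair-injective (x ∷ a) b (y ∷ a′) b′ eq with ∷-injective eq
... | refl , eq′ with pair-injective a b a′ b′ (∷-injectiveʳ eq′)
... | refl , refl = refl , refl

length-pair : ∀ a b → length (pair a b) ≡ 2 * length a + (2 + length b)
length-pair [] b = refl
length-pair (x ∷ a) b = trans (cong (λ z → 2 + z) (length-pair a b))
  (solve 2 (λ x y → con 2 :+ (con 2 :* x :+ y) := con 2 :* (con 1 :+ x) :+ y) refl (length a) (2 + length b))
  where open +-*-Solver

num-≤-++ˡ : ∀ s t → num s ≤ num (s ++ t)
num-≤-++ˡ s t = ∸-monoˡ-≤ 1 (≤-trans (numFrom-≥ (N s) t) (≤-reflexive (sym (numFrom-++ 1 s t))))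

numFrom-mono : ∀ {x y} s → x ≤ y → numFrom x s ≤ numFrom y s
numFrom-mono [] le = le
numFrom-mono (b ∷ s) le = numFrom-mono s (+-monoˡ-≤ (bit b) (*-monoʳ-≤ 2 le))

num-≤-++ʳ : ∀ s t → num t ≤ num (s ++ t)
num-≤-++ʳ s t = ∸-monoˡ-≤ 1 (≤-trans (numFrom-mono t (numFrom-≥ 1 s)) (≤-reflexive (sym (numFrom-++ 1 s t))))

num-≤-dbl : ∀ s → num s ≤ num (dbl s)
num-≤-dbl s = ∸-monoˡ-≤ 1 (go s ≤-refl)
  where
  go : ∀ {x y} s → x ≤ y → numFrom x s ≤ numFrom y (dbl s)
  go [] le = le
  go {x} {y} (b ∷ s) le = go s (≤-trans (+-monoˡ-≤ (bit b) (*-monoʳ-≤ 2 le)) (2*-bit (2 * y + bit b) b))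

opaque
  unfolding cat

  ⟪_,_⟫ : ℕ → ℕ → ℕ
  ⟪ x , y ⟫ = num (pair (str x) (str y))

  -- 4 is the number of the delimiter `false ∷ true ∷ []`.
  cat-⟪⟫ : ∀ x y → cat (cat (num (dbl (str x))) 4) y ≡ ⟪ x , y ⟫
  cat-⟪⟫ x y rewrite str-num (dbl (str x)) | str-num (dbl (str x) ++ (false ∷ true ∷ [])) =
    cong num (++-assoc (dbl (str x)) (false ∷ true ∷ []) (str y))

  num-pair : ∀ a b → num (pair a b) ≡ ⟪ num a , num b ⟫
  num-pair a b rewrite str-num a | str-num b = refl

  ⟪⟫-injective : ∀ x y x′ y′ → ⟪ x , y ⟫ ≡ ⟪ x′ , y′ ⟫ → x ≡ x′ × y ≡ y′
  ⟪⟫-injective x y x′ y′ eq with pair-injective (str x) (str y) (str x′) (str y′)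
    (num-injective (pair (str x) (str y)) (pair (str x′) (str y′)) eq)
  ... | eqx , eqy = trans (sym (num-str x)) (trans (cong num eqx) (num-str x′)) ,
      trans (sym (num-str y)) (trans (cong num eqy) (num-str y′))

  ⟪⟫-≥₁ : ∀ x y → x ≤ ⟪ x , y ⟫
  ⟪⟫-≥₁ x y = ≤-trans (≤-reflexive (sym (num-str x))) (≤-trans (num-≤-dbl (str x)) (num-≤-++ˡ (dbl (str x)) _))

  ⟪⟫-≥₂ : ∀ x y → y ≤ ⟪ x , y ⟫
  ⟪⟫-≥₂ x y = ≤-trans (≤-reflexive (sym (num-str y))) (≤-trans (num-≤-++ʳ (false ∷ true ∷ []) (str y)) (num-≤-++ʳ (dbl (str x)) _))

pairF : Fn n → Fn n → Fn n
pairF d e = ext (catF (catF (dblF d) (constF 4)) e) (λ xs → ⟪ fun d xs , fun e xs ⟫) (λ xs → cat-⟪⟫ (fun d xs) (fun e xs))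

opaque
  -- Components never exceed the code of their pair, so nested bounded searches invert the pairing.
  -- On numbers that code no pair the projections are arbitrary.
  sndGiven : ℕ → ℕ → ℕ
  sndGiven x u = least u (λ y → dist ⟪ x , y ⟫ u)

  π₁ π₂ : ℕ → ℕ
  π₁ u = least u (λ x → dist ⟪ x , sndGiven x u ⟫ u)
  π₂ u = sndGiven (π₁ u) u

  sndGiven-⟪⟫ : ∀ x y → ⟪ x , sndGiven x ⟪ x , y ⟫ ⟫ ≡ ⟪ x , y ⟫
  sndGiven-⟪⟫ x y = dist≡0 _ _ (least-zero ⟪ x , y ⟫ (λ z → dist ⟪ x , z ⟫ ⟪ x , y ⟫) (⟪⟫-≥₂ x y) (dist-refl ⟪ x , y ⟫))

  π₁π₂-⟪⟫ : ∀ x y → π₁ ⟪ x , y ⟫ ≡ x × π₂ ⟪ x , y ⟫ ≡ y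
  π₁π₂-⟪⟫ x y = ⟪⟫-injective _ _ x y (dist≡0 _ _ (least-zero ⟪ x , y ⟫ (λ z → dist ⟪ z , sndGiven z ⟪ x , y ⟫ ⟫ ⟪ x , y ⟫)
    (⟪⟫-≥₁ x y) (trans (cong (λ z → dist z ⟪ x , y ⟫) (sndGiven-⟪⟫ x y)) (dist-refl ⟪ x , y ⟫))))

  π₁-⟪⟫ : ∀ x y → π₁ ⟪ x , y ⟫ ≡ x
  π₁-⟪⟫ x y = proj₁ (π₁π₂-⟪⟫ x y)

  π₂-⟪⟫ : ∀ x y → π₂ ⟪ x , y ⟫ ≡ y
  π₂-⟪⟫ x y = proj₂ (π₁π₂-⟪⟫ x y)

  π₁-def : ∀ u → least u (λ x → dist ⟪ x , sndGiven x u ⟫ u) ≡ π₁ u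
  π₁-def u = refl

  π₂-def : ∀ u → sndGiven (π₁ u) u ≡ π₂ u
  π₂-def u = refl

  sndGiven-def : ∀ x u → least u (λ y → dist ⟪ x , y ⟫ u) ≡ sndGiven x u
  sndGiven-def x u = refl

sndGivenF : Fn n → Fn n → Fn n
sndGivenF d e = ext (body ⊙ (d ∷ e ∷ [])) (λ xs → sndGiven (fun d xs) (fun e xs)) (λ xs → sndGiven-def (fun d xs) (fun e xs))
  where
  body : Fn 2
  body = leastF (var (suc zero)) (distF (pairF (var (suc zero)) (var zero)) (var (suc (suc zero))))

π₁F π₂F : Fn n → Fn n
π₁F e = ext (body ⊙ (e ∷ [])) (λ xs → π₁ (fun e xs)) (λ xs → π₁-def (fun e xs))
  where
  body : Fn 1
  body = leastF (var zero) (distF (pairF (var zero) (sndGivenF (var zero) (var (suc zero)))) (var (suc zero)))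
π₂F e = ext (sndGivenF (π₁F e) e) (λ xs → π₂ (fun e xs)) (λ xs → π₂-def (fun e xs))

-- Finite sums

sum<-mono : ∀ b {f g} → (∀ i → i < b → f i ≤ g i) → sum< b f ≤ sum< b g
sum<-mono zero    f≤g = z≤n
sum<-mono (suc b) f≤g = +-mono-≤ (sum<-mono b (λ i i<b → f≤g i (m<n⇒m<1+n i<b))) (f≤g b ≤-refl)

sum<-extend : ∀ {b c} f → b ≤ c → sum< b f ≤ sum< c f
sum<-extend {b} f b≤c = go (≤⇒≤′ b≤c)
  where
  go : ∀ {c} → b ≤′ c → sum< b f ≤ sum< c f
  go ≤′-refl = ≤-refl
  go (≤′-step {c} le) = ≤-trans (go le) (m≤m+n (sum< c f) (f c))

term≤sum< : ∀ {i b} f → i < b → f i ≤ sum< b f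
term≤sum< {i} f i<b = ≤-trans (m≤n+m (f i) (sum< i f)) (sum<-extend f i<b)

sum<-+ : ∀ b f g → sum< b (λ i → f i + g i) ≡ sum< b f + sum< b g
sum<-+ zero    f g = refl
sum<-+ (suc b) f g = trans (cong (_+ (f b + g b)) (sum<-+ b f g))
  (solve 4 (λ x y u v → (x :+ y) :+ (u :+ v) := (x :+ u) :+ (y :+ v)) refl (sum< b f) (sum< b g) (f b) (g b))
  where open +-*-Solver

sum<-zero : ∀ b {f} → (∀ i → i < b → f i ≡ 0) → sum< b f ≡ 0
sum<-zero zero    f≡0 = refl
sum<-zero (suc b) f≡0 = cong₂ _+_ (sum<-zero b (λ i i<b → f≡0 i (m<n⇒m<1+n i<b))) (f≡0 b ≤-refl)

sum<-swap : ∀ a b (f : ℕ → ℕ → ℕ) → sum< a (λ i → sum< b (λ j → f i j)) ≡ sum< b (λ j → sum< a (λ i → f i j))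
sum<-swap zero    b f = sym (sum<-zero b (λ _ _ → refl))
sum<-swap (suc a) b f = trans (cong (_+ sum< b (f a)) (sum<-swap a b f)) (sym (sum<-+ b (λ j → sum< a (λ i → f i j)) (f a)))

sum<-≤-length : ∀ b {f} → (∀ i → i < b → f i ≤ 1) → sum< b f ≤ b
sum<-≤-length zero    f≤1 = z≤n
sum<-≤-length (suc b) f≤1 = ≤-trans (+-mono-≤ (sum<-≤-length b (λ i i<b → f≤1 i (m<n⇒m<1+n i<b))) (f≤1 b ≤-refl)) (≤-reflexive (+-comm b 1))

sum<-atMostOne : ∀ b f c → (∀ i → f i ≤ c) → (∀ i j → f i ≢ 0 → f j ≢ 0 → i ≡ j) → sum< b f ≤ c
sum<-atMostOne zero    f c f≤c unique = z≤n
sum<-atMostOne (suc b) f c f≤c unique with f b ≟ 0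
... | yes fb≡0 = ≤-trans (≤-reflexive (trans (cong (sum< b f +_) fb≡0) (+-identityʳ _))) (sum<-atMostOne b f c f≤c unique)
... | no  fb≢0 = ≤-trans (≤-reflexive (cong (_+ f b) (sum<-zero b others))) (f≤c b)
  where
  others : ∀ i → i < b → f i ≡ 0
  others i i<b with f i ≟ 0
  ... | yes fi≡0 = fi≡0
  ... | no  fi≢0 = ⊥-elim (<⇒≢ i<b (unique i b fi≢0 fb≢0))

isz : ℕ → ℕ
isz x = ifz x 1 0

δ : ℕ → ℕ → ℕ
δ x y = isz (dist x y)

δ-refl : ∀ x → δ x x ≡ 1
δ-refl x rewrite dist-refl x = refl

isz≢0 : ∀ x → isz x ≢ 0 → x ≡ 0
isz≢0 zero    ne = refl
isz≢0 (suc x) ne = ⊥-elim (ne refl)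

isz≤1 : ∀ x → isz x ≤ 1
isz≤1 zero    = ≤-refl
isz≤1 (suc _) = z≤n

δ≢0 : ∀ x y → δ x y ≢ 0 → x ≡ y
δ≢0 x y ne = dist≡0 x y (isz≢0 (dist x y) ne)

*≢0ˡ : ∀ x y → x * y ≢ 0 → x ≢ 0
*≢0ˡ x y ne refl = ne refl

*≢0ʳ : ∀ x y → x * y ≢ 0 → y ≢ 0
*≢0ʳ x y ne refl = ne (*-zeroʳ x)

≤1⇒*≤ : ∀ {x} y → x ≤ 1 → x * y ≤ y
≤1⇒*≤ y x≤1 = ≤-trans (*-monoˡ-≤ y x≤1) (≤-reflexive (*-identityˡ y))

-- Double counting over the classes `A t`: after exchanging the sums, every `t` in the support of
-- `f` finds its own class below `M`. The opposite inequality holds because no `t` lies in two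
-- classes.
sum<-classes-≥ : ∀ M T (A f : ℕ → ℕ) → (∀ t → t < T → f t ≢ 0 → A t < M) →
  sum< T f ≤ sum< M (λ a → sum< T (λ t → δ (A t) a * f t))
sum<-classes-≥ M T A f bounded = ≤-trans (sum<-mono T pointwise) (≤-reflexive (sum<-swap T M (λ t a → δ (A t) a * f t)))
  where
  pointwise : ∀ t → t < T → f t ≤ sum< M (λ a → δ (A t) a * f t)
  pointwise t t<T with f t ≟ 0
  ... | yes eq = ≤-trans (≤-reflexive eq) z≤n
  ... | no  ne = ≤-trans (≤-reflexive (sym (trans (cong (_* f t) (δ-refl (A t))) (*-identityˡ (f t)))))
                         (term≤sum< (λ a → δ (A t) a * f t) (bounded t t<T ne))

sum<-classes-≤ : ∀ M T (A f : ℕ → ℕ) → sum< M (λ a → sum< T (λ t → δ (A t) a * f t)) ≤ sum< T f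
sum<-classes-≤ M T A f = ≤-trans (≤-reflexive (sum<-swap M T (λ a t → δ (A t) a * f t))) (sum<-mono T (λ t _ →
  sum<-atMostOne M _ (f t) (λ a → ≤1⇒*≤ (f t) (isz≤1 (dist (A t) a)))
    λ a b na nb → trans (sym (δ≢0 (A t) a (*≢0ˡ _ _ na))) (δ≢0 (A t) b (*≢0ˡ _ _ nb))))

-- The largest power of two that is at most c (and 0 for c = 0)

lp : ℕ → ℕ
lp c = ifz c 0 (2 ^ len (pred c))

len-mono : ∀ {x y} → x ≤ y → len x ≤ len y
len-mono {x} {y} x≤y = s≤s⁻¹ (2^-cancel-< (len x) (suc (len y)) (≤-<-trans (len-lower x) (≤-<-trans (s≤s x≤y) (len-upper y))))

len-suc : ∀ x → len (suc x) ≡ len x ⊎ len (suc x) ≡ suc (len x)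
len-suc x with m≤n⇒m<n∨m≡n (len-mono (n≤1+n x))
... | inj₂ eq = inj₁ (sym eq)
... | inj₁ lt = inj₂ (≤-antisym (s≤s⁻¹ (2^-cancel-< (len (suc x)) (2 + len x)
    (≤-<-trans (≤-trans (len-lower (suc x)) (len-upper x)) (^-monoʳ-< 2 ≤-refl (n<1+n (suc (len x))))))) lt)

lp-≤ : ∀ c → lp c ≤ c
lp-≤ zero    = z≤n
lp-≤ (suc x) = len-lower x

lp-mono : ∀ c → lp c ≤ lp (suc c)
lp-mono zero    = z≤n
lp-mono (suc x) = ^-monoʳ-≤ 2 (len-mono (n≤1+n x))

-- Nonzero exactly when `suc c` is a power of two. It is then a power of two itself: 1 for `c = 0`,
-- otherwise half of `suc c`. Reserving increments of `lp` makes the reservations of one class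
-- telescope.
jump : ℕ → ℕ
jump c = lp (suc c) ∸ lp c

jump-zero : jump 0 ≡ 1
jump-zero = cong (2 ^_) (n≤0⇒n≡0 (len-≤ 0))

jump-suc : ∀ x → len (suc x) ≡ suc (len x) → jump (suc x) ≡ 2 ^ len x
jump-suc x eq rewrite eq = trans (m+n∸m≡n (2 ^ len x) (2 ^ len x + 0)) (+-identityʳ _)

jump-power : ∀ c → jump c ≡ 0 ⊎ ∃ λ j → jump c ≡ 2 ^ j
jump-power zero = inj₂ (0 , jump-zero)
jump-power (suc x) with len-suc x
... | inj₁ eq rewrite eq = inj₁ (n∸n≡0 (2 ^ len x))
... | inj₂ eq = inj₂ (len x , jump-suc x eq)

-- `y` is to be the index of an event with a reservation, `x` an index at or after it. The reserved
-- exponent `j` falls short of the length of `x` by at most one, which bounds the loss when `x`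
-- serves as a program.
last-jump : ∀ x → ∃ λ y → ∃ λ j → y ≤ x × jump y ≡ 2 ^ j × len x ≤ suc j
last-jump zero = 0 , 0 , z≤n , jump-zero , m≤n⇒m≤1+n (len-≤ 0)
last-jump (suc x) with len-suc x
... | inj₂ eq = suc x , len x , ≤-refl , jump-suc x eq , ≤-reflexive eq
... | inj₁ eq with last-jump x
... | y , j , y≤x , eqj , le = y , j , m≤n⇒m≤1+n y≤x , eqj , ≤-trans (≤-reflexive eq) le

-- Counting and code allocation for a sequence of events e with labels A

module Events (e A : ℕ → ℕ) (e≤1 : ∀ t → e t ≤ 1) where

  e≢0⇒1 : ∀ t → e t ≢ 0 → e t ≡ 1
  e≢0⇒1 t ne = ≤-antisym (e≤1 t) (n≢0⇒n>0 ne)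

  index : ℕ → ℕ → ℕ
  index a T = sum< T (λ t → e t * δ (A t) a)

  weight : ℕ → ℕ
  weight t = e t * jump (index (A t) t)

  index-suc : ∀ {a} t → e t ≢ 0 → A t ≡ a → index a (suc t) ≡ suc (index a t)
  index-suc t ne refl rewrite e≢0⇒1 t ne | δ-refl (A t) = +-comm (index (A t) t) 1

  index-injective : ∀ {a} t t′ → e t ≢ 0 → A t ≡ a → e t′ ≢ 0 → A t′ ≡ a → index a t ≡ index a t′ → t ≡ t′
  index-injective {a} t t′ ne eq ne′ eq′ same with <-cmp t t′
  ... | tri≈ _ t≡t′ _ = t≡t′
  ... | tri< t<t′ _ _ = ⊥-elim (<-irrefl same (≤-trans (≤-reflexive (sym (index-suc t ne eq))) (sum<-extend _ t<t′)))
  ... | tri> _ _ t′<t = ⊥-elim (<-irrefl (sym same) (≤-trans (≤-reflexive (sym (index-suc t′ ne′ eq′))) (sum<-extend _ t′<t)))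

  -- The count grows by at most one per stage and so skips no value.
  index-attained : ∀ a T y → y < index a T → ∃ λ t → e t ≢ 0 × A t ≡ a × index a t ≡ y
  index-attained a (suc T) y lt with y <? index a T
  ... | yes lt′ = index-attained a T y lt′
  ... | no  ge with e T * δ (A T) a ≟ 0
  ...   | yes eq = ⊥-elim (ge (≤-trans lt (≤-reflexive (trans (cong (index a T +_) eq) (+-identityʳ _)))))
  ...   | no  ne = T , *≢0ˡ (e T) _ ne , δ≢0 (A T) a (*≢0ʳ (e T) _ ne) ,
          ≤-antisym (≮⇒≥ ge) (s≤s⁻¹ (≤-trans lt (≤-reflexive (index-suc T (*≢0ˡ (e T) _ ne) (δ≢0 (A T) a (*≢0ʳ (e T) _ ne))))))

  -- The weights in one class telescope.
  class-weight : ∀ a T → sum< T (λ t → δ (A t) a * weight t) ≤ lp (index a T)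
  class-weight a zero = z≤n
  class-weight a (suc T) with e T * δ (A T) a ≟ 0
  ... | no ne = begin
    sum< T (λ t → δ (A t) a * weight t) + δ (A T) a * weight T   ≤⟨ +-mono-≤ (class-weight a T) (≤-reflexive last) ⟩
    lp (index a T) + jump (index a T)                            ≡⟨ m+[n∸m]≡n (lp-mono (index a T)) ⟩
    lp (suc (index a T))                                         ≡⟨ cong lp (index-suc T (*≢0ˡ (e T) _ ne) AT≡a) ⟨
    lp (index a (suc T))                                         ∎
    where
    open ≤-Reasoning
    AT≡a = δ≢0 (A T) a (*≢0ʳ (e T) _ ne)
    last : δ (A T) a * weight T ≡ jump (index a T)
    last rewrite AT≡a | δ-refl a | e≢0⇒1 T (*≢0ˡ (e T) _ ne) = trans (*-identityˡ _) (*-identityˡ _)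
  ... | yes eq = begin
    sum< T (λ t → δ (A t) a * weight t) + δ (A T) a * weight T   ≡⟨ cong (sum< T (λ t → δ (A t) a * weight t) +_) last ⟩
    sum< T (λ t → δ (A t) a * weight t) + 0                      ≡⟨ +-identityʳ _ ⟩
    sum< T (λ t → δ (A t) a * weight t)                          ≤⟨ class-weight a T ⟩
    lp (index a T)
      ≡⟨ cong lp (trans (cong (index a T +_) eq) (+-identityʳ _)) ⟨
    lp (index a (suc T))                                         ∎
    where
    open ≤-Reasoning
    last : δ (A T) a * weight T ≡ 0
    last = trans (solve 3 (λ d x y → d :* (x :* y) := (x :* d) :* y) refl (δ (A T) a) (e T) (jump (index (A T) T)))
      (cong (_* jump (index (A T) T)) eq)
      where open +-*-Solver

  total-weight : ∀ T → sum< T weight ≤ sum< T e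
  total-weight T = begin
    sum< T weight
      ≤⟨ sum<-classes-≥ M T A weight (λ t t<T _ → s≤s (term≤sum< A t<T)) ⟩
    sum< M (λ a → sum< T (λ t → δ (A t) a * weight t))
      ≤⟨ sum<-mono M (λ a _ → ≤-trans (class-weight a T) (lp-≤ (index a T))) ⟩
    sum< M (λ a → index a T)
      ≤⟨ sum<-mono M (λ a _ → sum<-mono T (λ t _ → ≤-reflexive (*-comm (e t) (δ (A t) a)))) ⟩
    sum< M (λ a → sum< T (λ t → δ (A t) a * e t))              ≤⟨ sum<-classes-≤ M T A e ⟩
    sum< T e                                                   ∎
    where
    open ≤-Reasoning
    -- Exceeds every label that occurs before stage `T`.
    M = suc (sum< T A)

  weight-power : ∀ t → weight t ≢ 0 → ∃ λ j → weight t ≡ 2 ^ j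
  weight-power t ne with jump-power (index (A t) t)
  ... | inj₁ eq = ⊥-elim (*≢0ʳ (e t) _ ne eq)
  ... | inj₂ (j , eq) = j , trans (cong₂ _*_ (e≢0⇒1 t (*≢0ˡ (e t) _ ne)) eq) (*-identityˡ _)

-- Pigeonhole principle: `p` maps the events injectively to numbers below `M`.
sum<-events : ∀ (e p : ℕ → ℕ) M → (∀ t → e t ≤ 1) → (∀ t → e t ≢ 0 → p t < M) →
  (∀ t t′ → e t ≢ 0 → e t′ ≢ 0 → p t ≡ p t′ → t ≡ t′) → ∀ T → sum< T e ≤ M
sum<-events e p M e≤1 p<M inj T = ≤-trans (sum<-classes-≥ M T p e (λ t _ → p<M t)) (sum<-≤-length M (λ a _ →
  sum<-atMostOne T _ 1 (λ t → ≤-trans (≤1⇒*≤ (e t) (isz≤1 (dist (p t) a))) (e≤1 t)) λ t t′ ne ne′ →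
    inj t t′ (*≢0ʳ (δ (p t) a) _ ne) (*≢0ʳ (δ (p t′) a) _ ne′)
      (trans (δ≢0 (p t) a (*≢0ˡ _ _ ne)) (sym (δ≢0 (p t′) a (*≢0ˡ _ _ ne′))))))

-- The requests w are served one after another from the interval [X , 2X), X = 2 ^ r; the request t
-- gets a segment of length 2 * w t, and its codeword is the aligned dyadic interval of length w t in it.

module Allocation (w : ℕ → ℕ) (r : ℕ) (w-power : ∀ t → w t ≢ 0 → ∃ λ j → w t ≡ 2 ^ j)
  (kraft : ∀ T → 2 * sum< T w ≤ 2 ^ r) where

  offset : ℕ → ℕ
  offset t = 2 ^ r + 2 * sum< t w

  Codeword : ℕ → ℕ → Set
  Codeword t x = w t ≢ 0 × offset t ≤ x * w t × x * w t < offset t + w t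

  offset-suc : ∀ t → offset t + w t + w t ≡ offset (suc t)
  offset-suc t = solve 3 (λ x s w → (x :+ con 2 :* s) :+ w :+ w := x :+ con 2 :* (s :+ w)) refl (2 ^ r) (sum< t w) (w t)
    where open +-*-Solver

  offset-mono : ∀ {t t′} → t ≤ t′ → offset t ≤ offset t′
  offset-mono le = +-monoʳ-≤ (2 ^ r) (*-monoʳ-≤ 2 (sum<-extend w le))

  codeword-end : ∀ t x → Codeword t x → suc x * w t ≤ offset (suc t)
  codeword-end t x (_ , _ , lt) = begin
    w t + x * w t            ≡⟨ +-comm (w t) _ ⟩
    x * w t + w t            ≤⟨ +-monoˡ-≤ (w t) (<⇒≤ lt) ⟩
    offset t + w t + w t      ≡⟨ offset-suc t ⟩
    offset (suc t)            ∎
    where open ≤-Reasoning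

  -- The interval of the codeword lies between `2 ^ r` and `2 ^ suc r`, while `N p` lies between
  -- `2 ^ length p` and its double. Comparing powers of two leaves one possible length.
  codeword-length : ∀ t p j → w t ≡ 2 ^ j → Codeword t (N p) → length p + j ≡ r
  codeword-length t p j eq cw@(_ , lower , _) = ≤-antisym (s≤s⁻¹ (2^-cancel-< _ _ above)) (s≤s⁻¹ (2^-cancel-< _ _ below))
    where
    open ≤-Reasoning
    above : 2 ^ (length p + j) < 2 ^ suc r
    above = begin-strict
      2 ^ (length p + j)      ≡⟨ ^-distribˡ-+-* 2 (length p) j ⟩
      2 ^ length p * 2 ^ j    ≤⟨ *-monoˡ-≤ (2 ^ j) (N-lower p) ⟩
      N p * 2 ^ j             <⟨ *-monoˡ-< (2 ^ j) {{m^n≢0 2 j}} (n<1+n (N p)) ⟩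
      suc (N p) * 2 ^ j       ≡⟨ cong (suc (N p) *_) eq ⟨
      suc (N p) * w t         ≤⟨ codeword-end t (N p) cw ⟩
      offset (suc t)           ≤⟨ +-monoʳ-≤ (2 ^ r) (kraft (suc t)) ⟩
      2 ^ r + 2 ^ r           ≡⟨ cong (2 ^ r +_) (+-identityʳ (2 ^ r)) ⟨
      2 ^ suc r               ∎
    below : 2 ^ r < 2 ^ suc (length p + j)
    below = begin-strict
      2 ^ r                          ≤⟨ m≤m+n (2 ^ r) _ ⟩
      offset t                        ≤⟨ lower ⟩
      N p * w t                      ≡⟨ cong (N p *_) eq ⟩
      N p * 2 ^ j                    <⟨ *-monoˡ-< (2 ^ j) {{m^n≢0 2 j}} (N-upper p) ⟩
      2 ^ suc (length p) * 2 ^ j     ≡⟨ ^-distribˡ-+-* 2 (suc (length p)) j ⟨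
      2 ^ suc (length p + j)         ∎

  codeword-exists : ∀ t → w t ≢ 0 → ∃ λ p → Codeword t (N p)
  codeword-exists t ne with multiple (offset t)
    where
    multiple : ∀ y → ∃ λ x → y ≤ x * w t × x * w t < y + w t
    multiple zero = 0 , z≤n , n≢0⇒n>0 ne
    multiple (suc y) with multiple y
    ... | x , lower , upper with m≤n⇒m<n∨m≡n lower
    ... | inj₁ lt = x , lt , m<n⇒m<1+n upper
    ... | inj₂ eq = suc x , subst (λ z → suc y ≤ w t + z) eq (+-monoˡ-≤ y (n≢0⇒n>0 ne)) ,
        s≤s (≤-reflexive (trans (cong (w t +_) (sym eq)) (+-comm (w t) y)))
  -- `N` never takes the value 0; the multiple 0 is excluded because the offset is positive.
  ... | zero  , lower , upper = ⊥-elim (<⇒≱ (m^n>0 2 r) (≤-trans (m≤m+n (2 ^ r) _) lower))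
  ... | suc x , cw = str x , subst (Codeword t) (sym (N-str x)) (ne , cw)

  -- The interval of `p ++ q` is contained in that of `p`, whereas different requests own disjoint
  -- segments; so the requests coincide. A request fixes the length of its codewords, hence `q` is
  -- empty.
  codeword-prefix : ∀ t t′ p q → Codeword t (N p) → Codeword t′ (N (p ++ q)) → t ≡ t′ × q ≡ []
  codeword-prefix t t′ p q cw cw′ with w-power t (proj₁ cw) | w-power t′ (proj₁ cw′)
  ... | j , eqj | j′ , eqj′ = t≡t′ , length≡0 q (+-cancelʳ-≡ j′ (length q) 0 (trans (sym j≡) j≡j′))
    where
    open ≤-Reasoning
    j≡ : j ≡ length q + j′
    j≡ = +-cancelˡ-≡ (length p) j (length q + j′) (begin-equality
      length p + j                  ≡⟨ codeword-length t p j eqj cw ⟩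
      r                             ≡⟨ codeword-length t′ (p ++ q) j′ eqj′ cw′ ⟨
      length (p ++ q) + j′          ≡⟨ cong (_+ j′) (length-++ p) ⟩
      length p + length q + j′      ≡⟨ +-assoc (length p) _ _ ⟩
      length p + (length q + j′)    ∎)
    w≡ : w t ≡ 2 ^ length q * w t′
    w≡ = begin-equality
      w t                       ≡⟨ eqj ⟩
      2 ^ j                     ≡⟨ cong (2 ^_) j≡ ⟩
      2 ^ (length q + j′)       ≡⟨ ^-distribˡ-+-* 2 (length q) j′ ⟩
      2 ^ length q * 2 ^ j′     ≡⟨ cong (2 ^ length q *_) eqj′ ⟨
      2 ^ length q * w t′       ∎
    lower : N p * w t ≤ N (p ++ q) * w t′
    lower = begin
      N p * w t                         ≡⟨ cong (N p *_) w≡ ⟩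
      N p * (2 ^ length q * w t′)       ≡⟨ *-assoc (N p) _ _ ⟨
      N p * 2 ^ length q * w t′         ≤⟨ *-monoˡ-≤ (w t′) (numFrom-lower (N p) q) ⟩
      numFrom (N p) q * w t′            ≡⟨ cong (_* w t′) (numFrom-++ 1 p q) ⟨
      N (p ++ q) * w t′                 ∎
    upper : suc (N (p ++ q)) * w t′ ≤ suc (N p) * w t
    upper = begin
      suc (N (p ++ q)) * w t′              ≡⟨ cong (λ z → suc z * w t′) (numFrom-++ 1 p q) ⟩
      suc (numFrom (N p) q) * w t′         ≤⟨ *-monoˡ-≤ (w t′) (numFrom-upper (N p) q) ⟩
      suc (N p) * 2 ^ length q * w t′      ≡⟨ *-assoc (suc (N p)) (2 ^ length q) (w t′) ⟩
      suc (N p) * (2 ^ length q * w t′)    ≡⟨ cong (suc (N p) *_) w≡ ⟨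
      suc (N p) * w t                      ∎
    w′-positive : N (p ++ q) * w t′ < suc (N (p ++ q)) * w t′
    w′-positive = *-monoˡ-< (w t′) {{≢-nonZero (proj₁ cw′)}} (n<1+n (N (p ++ q)))
    t≡t′ : t ≡ t′
    t≡t′ with <-cmp t t′
    ... | tri≈ _ eq _ = eq
    ... | tri< t<t′ _ _ = ⊥-elim (<-irrefl refl (begin-strict
      suc (N p) * w t             ≤⟨ codeword-end t (N p) cw ⟩
      offset (suc t)               ≤⟨ offset-mono t<t′ ⟩
      offset t′                    ≤⟨ proj₁ (proj₂ cw′) ⟩
      N (p ++ q) * w t′           <⟨ w′-positive ⟩
      suc (N (p ++ q)) * w t′     ≤⟨ upper ⟩
      suc (N p) * w t             ∎))
    ... | tri> _ _ t′<t = ⊥-elim (<-irrefl refl (begin-strict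
      N (p ++ q) * w t′           <⟨ w′-positive ⟩
      suc (N (p ++ q)) * w t′     ≤⟨ codeword-end t′ (N (p ++ q)) cw′ ⟩
      offset (suc t′)              ≤⟨ offset-mono t′<t ⟩
      offset t                     ≤⟨ proj₁ (proj₂ cw) ⟩
      N p * w t                   ≤⟨ lower ⟩
      N (p ++ q) * w t′           ∎))
    j≡j′ : j ≡ j′
    j≡j′ = +-cancelˡ-≡ (length p) j j′ (trans (codeword-length t p j eqj cw) (sym (codeword-length t p j′ (trans (cong w t≡t′) eqj′) cw)))
    length≡0 : ∀ s → length s ≡ 0 → s ≡ []
    length≡0 [] eq = refl

-- Machines on numbers and on strings

opaque
  run : Machine → ℕ → ℕ → ℕ → ℕ
  run M t p x = fun (clocked M) (t ∷ p ∷ x ∷ [])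

  run-def : ∀ M t p x → fun (clocked M) (t ∷ p ∷ x ∷ []) ≡ run M t p x
  run-def M t p x = refl

  run-complete : ∀ {M p x y} → M ⟨ p ∷ x ∷ [] ⟩⇓ y → ∃ λ k → ∀ k′ → k ≤ k′ → run M k′ p x ≡ suc y
  run-complete {M} {p} {x} (k , eq) = k , clocked-complete k M (p ∷ x ∷ []) eq

  run-sound : ∀ M t p x {y} → run M t p x ≡ suc y → M ⟨ p ∷ x ∷ [] ⟩⇓ y
  run-sound M t p x = clocked-sound M t (p ∷ x ∷ [])

runF : Machine → Fn n → Fn n → Fn n → Fn n
runF M t p x = ext (clocked M ⊙ (t ∷ p ∷ x ∷ [])) (λ xs → run M (fun t xs) (fun p xs) (fun x xs))
  (λ xs → run-def M (fun t xs) (fun p xs) (fun x xs))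

Runs-str⇒⇓ : ∀ M p n y → Runs M p (str n) y → M ⟨ num p ∷ n ∷ [] ⟩⇓ num y
Runs-str⇒⇓ M p n y (k , eq) = subst (λ z → M ⟨ num p ∷ z ∷ [] ⟩⇓ num y) (num-str n) (k , eq)

Runs-pair⇒⇓ : ∀ M p a n y → Runs M p (pair a (str n)) y → M ⟨ num p ∷ ⟪ num a , n ⟫ ∷ [] ⟩⇓ num y
Runs-pair⇒⇓ M p a n y (k , eq) = subst (λ z → M ⟨ num p ∷ z ∷ [] ⟩⇓ num y)
  (trans (num-pair a (str n)) (cong ⟪ num a ,_⟫ (num-str n))) (k , eq)

⇓⇒Runs : ∀ {M} p x y {p′ x′ y′} → M ⟨ p′ ∷ x′ ∷ [] ⟩⇓ y′ → p′ ≡ num p → x′ ≡ num x → y′ ≡ num y → Runs M p x y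
⇓⇒Runs p x y (k , eq) refl refl refl = k , eq

++-prefix : ∀ (p p′ : Str) {q q′} → p ++ q ≡ p′ ++ q′ → (∃ λ r → p′ ≡ p ++ r) ⊎ (∃ λ r → p ≡ p′ ++ r)
++-prefix [] p′ eq = inj₁ (p′ , refl)
++-prefix (b ∷ p) [] eq = inj₂ (b ∷ p , refl)
++-prefix (b ∷ p) (c ∷ p′) eq with ∷-injective eq
... | refl , eq′ with ++-prefix p p′ eq′
... | inj₁ (r , refl) = inj₁ (r , refl)
... | inj₂ (r , refl) = inj₂ (r , refl)

-- Of two prefixes of one string, one extends the other; both halt under the same condition, so the
-- extension is empty.
prefixFree-unique : ∀ {V} → PrefixFree V → ∀ x p p′ {q q′} y y′ → Runs V p x y → Runs V p′ x y′ → p ++ q ≡ p′ ++ q′ → p ≡ p′ × q ≡ q′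
prefixFree-unique pf x p p′ {q} {q′} y y′ run run′ eq with ++-prefix p p′ eq
... | inj₁ (r , refl) with pf x p r y y′ run run′
...   | refl = sym (++-identityʳ p) , ++-cancelˡ p q q′ (trans eq (cong (_++ q′) (++-identityʳ p)))
prefixFree-unique pf x p p′ {q} {q′} y y′ run run′ eq | inj₂ (r , refl) with pf x p′ r y′ y run′ run
...   | refl = ++-identityʳ p′ , ++-cancelˡ p′ q q′ (trans (cong (_++ q) (sym (++-identityʳ p′))) eq)

-- Upper bound: one program for the pair from programs for its parts.

module Joint (U V : Machine) where

  attempt : ℕ → ℕ → ℕ → ℕ → ℕ → ℕ
  attempt p q t s n = ifz (dist (cat p q) s)
    (ifz (run V t p n) 0 (ifz (run U t q ⟪ pred (run V t p n) , n ⟫) 0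
      (suc ⟪ pred (run V t p n) , pred (run U t q ⟪ pred (run V t p n) , n ⟫) ⟫))) 0

  attempt-success : ∀ p q t s n {a b} → cat p q ≡ s → run V t p n ≡ suc a → run U t q ⟪ a , n ⟫ ≡ suc b →
    attempt p q t s n ≡ suc ⟪ a , b ⟫
  attempt-success p q t s n refl eqV eqU rewrite dist-refl (cat p q) | eqV | eqU = refl

  attempt-success⁻¹ : ∀ p q t s n {y} → attempt p q t s n ≡ suc y →
    ∃ λ a → ∃ λ b → cat p q ≡ s × V ⟨ p ∷ n ∷ [] ⟩⇓ a × U ⟨ q ∷ ⟪ a , n ⟫ ∷ [] ⟩⇓ b × y ≡ ⟪ a , b ⟫
  attempt-success⁻¹ p q t s n eq with ifz-suc-0 (dist (cat p q) s) eq
  ... | split , eq₁ with run V t p n in eqV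
  ... | suc a with run U t q ⟪ a , n ⟫ in eqU
  ... | suc b = a , b , dist≡0 _ _ split , run-sound V t p n eqV , run-sound U t q _ eqU , suc-injective (sym eq₁)

  attempt-complete : ∀ a b p q n → Runs V p (str n) a → Runs U q (pair a (str n)) b →
    ∃ λ t → attempt (num p) (num q) t (num (p ++ q)) n ≡ suc ⟪ num a , num b ⟫
  attempt-complete a b p q n runV runU with run-complete (Runs-str⇒⇓ V p n a runV) | run-complete (Runs-pair⇒⇓ U q a n b runU)
  ... | k , eqV | l , eqU = k ⊔ l , attempt-success (num p) (num q) (k ⊔ l) (num (p ++ q)) n
    (cat-num p q) (eqV (k ⊔ l) (m≤m⊔n k l)) (eqU (k ⊔ l) (m≤n⊔m k l))

  -- Prefix-freeness under the fixed condition `str n` leaves a single split of `p ++ q`;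
  -- determinism of both runs then fixes the output.
  attempt-unique : PrefixFree V → ∀ a b p q n → Runs V p (str n) a → Runs U q (pair a (str n)) b →
    ∀ p′ q′ t {y} → attempt p′ q′ t (num (p ++ q)) n ≡ suc y → y ≡ num (pair a b)
  attempt-unique pf a b p q n runV runU p′ q′ t {y} eq with attempt-success⁻¹ p′ q′ t (num (p ++ q)) n eq
  ... | a′ , b′ , split , runV′ , runU′ , refl with prefixFree-unique pf (str n) p (str p′) a (str a′) runV
        (⇓⇒Runs (str p′) (str n) (str a′) runV′ (sym (num-str p′)) (sym (num-str n)) (sym (num-str a′)))
        (sym (cat-injective p′ q′ (p ++ q) split))
  ... | p≡ , q≡ = begin
    ⟪ a′ , b′ ⟫            ≡⟨ cong₂ ⟪_,_⟫ a′≡ b′≡ ⟩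
    ⟪ num a , num b ⟫      ≡⟨ num-pair a b ⟨
    num (pair a b)         ∎
    where
    open ≡-Reasoning
    code≡ : ∀ {s x} → s ≡ str x → x ≡ num s
    code≡ {x = x} eq = trans (sym (num-str x)) (cong num (sym eq))
    a′≡ : a′ ≡ num a
    a′≡ = ⇓-unique (subst (λ z → V ⟨ z ∷ n ∷ [] ⟩⇓ a′) (code≡ p≡) runV′) (Runs-str⇒⇓ V p n a runV)
    b′≡ : b′ ≡ num b
    b′≡ = ⇓-unique (subst₂ (λ z x → U ⟨ z ∷ ⟪ x , n ⟫ ∷ [] ⟩⇓ b′) (code≡ q≡) a′≡ runU′) (Runs-pair⇒⇓ U q a n b runU)

  opaque
    attemptF : Fn 3
    attemptF = ifzF (distF (catF p q) s) (ifzF v zeroF (ifzF u zeroF (sucF (pairF (predF v) (predF u))))) zeroF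
      where
      p q t s c v u : Fn 3
      -- The search variable codes a guessed split `p`, `q` and a clock.
      p = π₁F (var zero)
      q = π₁F (π₂F (var zero))
      t = π₂F (π₂F (var zero))
      s = π₂F (var (suc zero))
      c = lenF s +F π₁F (var (suc zero))
      v = runF V t p c
      u = runF U t q (pairF (predF v) c)

    attemptF-fun : ∀ u s d x → fun attemptF (u ∷ num (pair (str d) s) ∷ x ∷ []) ≡
      attempt (π₁ u) (π₁ (π₂ u)) (π₂ (π₂ u)) (num s) (length s + d)
    attemptF-fun u s d x = cong₂ (attempt (π₁ u) (π₁ (π₂ u)) (π₂ (π₂ u)))
      snd (cong₂ _+_ (trans (cong len snd) (len-num s)) fst)
      where
      w≡ : num (pair (str d) s) ≡ ⟪ d , num s ⟫
      w≡ = trans (num-pair (str d) s) (cong ⟪_, num s ⟫ (num-str d))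
      fst : π₁ (num (pair (str d) s)) ≡ d
      fst = trans (cong π₁ w≡) (π₁-⟪⟫ d (num s))
      snd : π₂ (num (pair (str d) s)) ≡ num s
      snd = trans (cong π₂ w≡) (π₂-⟪⟫ d (num s))

  joint : Machine
  joint = searcher attemptF

  joint-runs : PrefixFree V → ∀ a b p q n d → Runs V p (str n) a → Runs U q (pair a (str n)) b →
    length (p ++ q) + d ≡ n → Runs joint (pair (str d) (p ++ q)) [] (pair a b)
  joint-runs pf a b p q n d runV runU refl = ⇓⇒Runs (pair (str d) (p ++ q)) [] (pair a b)
    (searcher-computes attemptF (num (pair (str d) (p ++ q)) ∷ 0 ∷ []) found
      (λ u eq → attempt-unique pf a b p q n runV runU (π₁ u) (π₁ (π₂ u)) (π₂ (π₂ u)) (trans (sym (attemptF-fun u (p ++ q) d 0)) eq)))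
    refl refl refl
    where
    t u : ℕ
    t = proj₁ (attempt-complete a b p q n runV runU)
    u = ⟪ num p , ⟪ num q , t ⟫ ⟫
    found : fun attemptF (u ∷ num (pair (str d) (p ++ q)) ∷ 0 ∷ []) ≡ suc (num (pair a b))
    found = begin
      fun attemptF (u ∷ num (pair (str d) (p ++ q)) ∷ 0 ∷ [])                   ≡⟨ attemptF-fun u (p ++ q) d 0 ⟩
      attempt (π₁ u) (π₁ (π₂ u)) (π₂ (π₂ u)) (num (p ++ q)) n
        ≡⟨ cong₂ (λ x y → attempt x (π₁ y) (π₂ y) (num (p ++ q)) n) (π₁-⟪⟫ (num p) _) (π₂-⟪⟫ (num p) _) ⟩
      attempt (num p) (π₁ ⟪ num q , t ⟫) (π₂ ⟪ num q , t ⟫) (num (p ++ q)) n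
        ≡⟨ cong₂ (λ x y → attempt (num p) x y (num (p ++ q)) n) (π₁-⟪⟫ (num q) t) (π₂-⟪⟫ (num q) t) ⟩
      attempt (num p) (num q) t (num (p ++ q)) n
        ≡⟨ proj₂ (attempt-complete a b p q n runV runU) ⟩
      suc ⟪ num a , num b ⟫                                                     ≡⟨ cong suc (num-pair a b) ⟨
      suc (num (pair a b))                                                      ∎
      where open ≡-Reasoning

-- The induction step needs `4 ≤ 2 ^ x`, which holds from 2 on; the 8 covers the small cases.
4*n≤2^n+8 : ∀ x → 4 * x ≤ 2 ^ x + 8
4*n≤2^n+8 0 = z≤n
4*n≤2^n+8 1 = m≤m+n 4 6
4*n≤2^n+8 2 = m≤m+n 8 4
4*n≤2^n+8 (suc x@(suc (suc y))) = begin
  4 * suc x                 ≡⟨ *-suc 4 x ⟩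
  4 + 4 * x                 ≤⟨ +-mono-≤ (^-monoʳ-≤ 2 (m≤m+n 2 y)) (4*n≤2^n+8 x) ⟩
  2 ^ x + (2 ^ x + 8)       ≡⟨ solve 1 (λ z → z :+ (z :+ con 8) := con 2 :* z :+ con 8) refl (2 ^ x) ⟩
  2 ^ suc x + 8             ∎
  where
  open ≤-Reasoning
  open +-*-Solver

-- After doubling, `4 * len d` is at most `2 ^ len d + 8`, hence at most `d + 9`, and one `d`
-- cancels.
≤2len⇒bounded : ∀ d c → d ≤ 2 * len d + c → d ≤ 9 + 2 * c
≤2len⇒bounded d c le = +-cancelˡ-≤ d d (9 + 2 * c) (begin
  d + d                         ≡⟨ cong (d +_) (+-identityʳ d) ⟨
  2 * d                         ≤⟨ *-monoʳ-≤ 2 le ⟩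
  2 * (2 * len d + c)
    ≡⟨ solve 2 (λ x c → con 2 :* (con 2 :* x :+ c) := con 4 :* x :+ con 2 :* c) refl (len d) c ⟩
  4 * len d + 2 * c             ≤⟨ +-monoˡ-≤ (2 * c) (4*n≤2^n+8 (len d)) ⟩
  2 ^ len d + 8 + 2 * c         ≤⟨ +-monoˡ-≤ (2 * c) (+-monoˡ-≤ 8 (len-lower d)) ⟩
  suc d + 8 + 2 * c
    ≡⟨ solve 2 (λ x c → (con 1 :+ x) :+ con 8 :+ con 2 :* c := x :+ (con 9 :+ con 2 :* c)) refl d c ⟩
  d + (9 + 2 * c)               ∎)
  where
  open ≤-Reasoning
  open +-*-Solver

joint-bound : (U V : Machine) → Optimal U → OptimalPF V →
  ∃ λ c → ∀ a b n m k → IsComplexity U (pair a b) [] n → IsComplexity V a (str n) m → IsComplexity U b (pair a (str n)) k →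
    n ≤ m + k + c
joint-bound U V optU (pf , _) with optU (Joint.joint U V)
-- The inner 2 is the delimiter of the pair, `c` the cost of simulating `joint`.
... | c , simulate = 9 + 2 * (2 + c) , bound
  where
  bound : ∀ a b n m k → IsComplexity U (pair a b) [] n → IsComplexity V a (str n) m → IsComplexity U b (pair a (str n)) k →
    n ≤ m + k + (9 + 2 * (2 + c))
  bound a b n m k (_ , minimal) ((p , runV , refl) , _) ((q , runU , refl) , _) with ≤-total n (length p + length q)
  ... | inj₁ n≤ = ≤-trans n≤ (m≤m+n _ _)
  ... | inj₂ ≤n with simulate (pair (str (n ∸ (length p + length q))) (p ++ q)) [] (pair a b)
                       (Joint.joint-runs U V pf a b p q n (n ∸ (length p + length q)) runV runU
                       (trans (cong (_+ (n ∸ (length p + length q))) (length-++ p)) (m+[n∸m]≡n ≤n)))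
  ... | w , runW , lenW = ≤-trans (≤-reflexive (sym (m+[n∸m]≡n ≤n))) (+-monoʳ-≤ s (≤2len⇒bounded d (2 + c) (+-cancelˡ-≤ s d _ (begin
      s + d                                          ≡⟨ m+[n∸m]≡n ≤n ⟩
      n                                              ≤⟨ minimal w runW ⟩
      length w                                       ≤⟨ lenW ⟩
      length (pair (str d) (p ++ q)) + c
        ≡⟨ cong (_+ c) (trans (length-pair (str d) (p ++ q)) (cong (λ l → 2 * l + (2 + length (p ++ q))) (length-str d))) ⟩
      2 * len d + (2 + length (p ++ q)) + c          ≡⟨ cong (λ z → 2 * len d + (2 + z) + c) (length-++ p) ⟩
      2 * len d + (2 + s) + c
        ≡⟨ solve 3 (λ l s c → l :+ (con 2 :+ s) :+ c := s :+ (l :+ (con 2 :+ c))) refl (2 * len d) s c ⟩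
      s + (2 * len d + (2 + c))                      ∎))))
    where
    open ≤-Reasoning
    open +-*-Solver
    s = length p + length q
    d = n ∸ s

-- Lower bound: enumeration of halting programs.

iszF : Fn n → Fn n
iszF e = ifzF e (sucF zeroF) zeroF

-- An event at stage ⟪ p , t ⟫: the program p of length n halts at clock t, but not earlier.
module Halting (U : Machine) where

  opaque
    -- A conjunction encoded as the vanishing of a sum; the final 0 in `run` is the number of the
    -- empty condition. Rejecting numbers that code no pair, and clocks after the first successful
    -- one, leaves at most one event per program, as the counting requires.
    event : ℕ → ℕ → ℕ
    event n u = isz (dist u ⟪ π₁ u , π₂ u ⟫ + dist (len (π₁ u)) n + isz (run U (π₂ u) (π₁ u) 0)
      + sum< (π₂ u) (λ t → run U t (π₁ u) 0))

    event-def : ∀ n u → isz (dist u ⟪ π₁ u , π₂ u ⟫ + dist (len (π₁ u)) n + isz (run U (π₂ u) (π₁ u) 0)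
      + sum< (π₂ u) (λ t → run U t (π₁ u) 0)) ≡ event n u
    event-def n u = refl

    event≤1 : ∀ n u → event n u ≤ 1
    event≤1 n u = isz≤1 _

    event⁻¹ : ∀ n u → event n u ≢ 0 →
      u ≡ ⟪ π₁ u , π₂ u ⟫ × len (π₁ u) ≡ n × run U (π₂ u) (π₁ u) 0 ≢ 0 × sum< (π₂ u) (λ t → run U t (π₁ u) 0) ≡ 0
    event⁻¹ n u ne = dist≡0 _ _ (m+n≡0⇒m≡0 _ x+y≡0) , dist≡0 _ _ (m+n≡0⇒n≡0 (dist u ⟪ π₁ u , π₂ u ⟫) x+y≡0) ,
        (λ eq → 1+n≢0 (trans (cong isz (sym eq)) (m+n≡0⇒n≡0 (dist u ⟪ π₁ u , π₂ u ⟫ + dist (len (π₁ u)) n) x+y+z≡0))) ,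
        m+n≡0⇒n≡0 (dist u ⟪ π₁ u , π₂ u ⟫ + dist (len (π₁ u)) n + isz (run U (π₂ u) (π₁ u) 0)) all≡0
      where
      all≡0 : dist u ⟪ π₁ u , π₂ u ⟫ + dist (len (π₁ u)) n + isz (run U (π₂ u) (π₁ u) 0) + sum< (π₂ u) (λ t → run U t (π₁ u) 0) ≡ 0
      all≡0 = isz≢0 _ ne
      x+y+z≡0 : dist u ⟪ π₁ u , π₂ u ⟫ + dist (len (π₁ u)) n + isz (run U (π₂ u) (π₁ u) 0) ≡ 0
      x+y+z≡0 = m+n≡0⇒m≡0 _ all≡0
      x+y≡0 : dist u ⟪ π₁ u , π₂ u ⟫ + dist (len (π₁ u)) n ≡ 0
      x+y≡0 = m+n≡0⇒m≡0 _ x+y+z≡0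

    event-⟪⟫ : ∀ p t {y} → run U t p 0 ≡ suc y → sum< t (λ t → run U t p 0) ≡ 0 → event (len p) ⟪ p , t ⟫ ≡ 1
    event-⟪⟫ p t halts first rewrite π₁-⟪⟫ p t | π₂-⟪⟫ p t | dist-refl ⟪ p , t ⟫ | dist-refl (len p) | halts | first = refl

    output : ℕ → ℕ
    output u = pred (run U (π₂ u) (π₁ u) 0)

    output-def : ∀ u → pred (run U (π₂ u) (π₁ u) 0) ≡ output u
    output-def u = refl

    output-⟪⟫ : ∀ p t {y} → run U t p 0 ≡ suc y → output ⟪ p , t ⟫ ≡ y
    output-⟪⟫ p t halts rewrite π₁-⟪⟫ p t | π₂-⟪⟫ p t | halts = refl

  label : ℕ → ℕ
  label u = π₁ (output u)

  event-injective : ∀ n u v → event n u ≢ 0 → event n v ≢ 0 → π₁ u ≡ π₁ v → u ≡ v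
  event-injective n u v eu ev same with event⁻¹ n u eu | event⁻¹ n v ev
  ... | u≡ , _ , halts , first | v≡ , _ , halts′ , first′ = trans u≡ (trans (cong₂ ⟪_,_⟫ same clock≡) (sym v≡))
    where
    later : ∀ p {s t} → run U s p 0 ≢ 0 → sum< t (λ t → run U t p 0) ≡ 0 → t ≤ s
    later p {s} {t} halts first = ≮⇒≥ λ s<t → halts (n≤0⇒n≡0 (≤-trans (term≤sum< (λ t → run U t p 0) s<t) (≤-reflexive first)))
    clock≡ : π₂ u ≡ π₂ v
    clock≡ = ≤-antisym (later (π₁ u) (subst (λ p → run U (π₂ v) p 0 ≢ 0) (sym same) halts′) first)
                       (later (π₁ v) (subst (λ p → run U (π₂ u) p 0 ≢ 0) same halts) first′)

  -- Events are told apart by the numbers of their programs, and a string of length `n` has a number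
  -- below `2 ^ suc n`.
  event-count : ∀ n T → sum< T (event n) ≤ 2 ^ suc n
  event-count n = sum<-events (event n) π₁ (2 ^ suc n) (event≤1 n) program< (event-injective n)
    where
    program< : ∀ u → event n u ≢ 0 → π₁ u < 2 ^ suc n
    program< u ne = <-trans (n<1+n (π₁ u)) (subst (λ l → suc (π₁ u) < 2 ^ suc l) (proj₁ (proj₂ (event⁻¹ n u ne))) (len-upper (π₁ u)))

  program-event : ∀ p a b → Runs U p [] (pair a b) →
    ∃ λ u → event (length p) u ≢ 0 × label u ≡ num a × π₂ (output u) ≡ num b
  program-event p a b runs = ⟪ num p , t ⟫ ,
      (λ eq → 1+n≢0 (trans (sym (event-⟪⟫ (num p) t halts first)) (trans (cong (λ l → event l ⟪ num p , t ⟫) (len-num p)) eq))) ,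
      trans (cong π₁ output≡) (π₁-⟪⟫ (num a) (num b)) , trans (cong π₂ output≡) (π₂-⟪⟫ (num a) (num b))
    where
    ab⇓ : U ⟨ num p ∷ 0 ∷ [] ⟩⇓ num (pair a b)
    ab⇓ = proj₁ runs , proj₂ runs
    K = proj₁ (run-complete ab⇓)
    pending : ℕ → ℕ
    pending t = isz (run U t (num p) 0)
    t = least K pending
    halts : run U t (num p) 0 ≡ suc (num (pair a b))
    halts with run U t (num p) 0 in eq | least-zero K pending ≤-refl (cong isz (proj₂ (run-complete ab⇓) K ≤-refl))
    ... | suc y | _ = cong suc (⇓-unique (run-sound U t (num p) 0 eq) ab⇓)
    first : sum< t (λ t → run U t (num p) 0) ≡ 0
    first = sum<-zero t λ i i<t → isz≢0 _ (least-below K pending i i<t)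
    output≡ : output ⟪ num p , t ⟫ ≡ ⟪ num a , num b ⟫
    output≡ = trans (output-⟪⟫ (num p) t halts) (num-pair a b)

  module Ev n = Events (event n) label (event≤1 n)

  -- One of the two extra bits comes from `event-count`, the other from the doubled segments.
  kraft : ∀ n T → 2 * sum< T (Ev.weight n) ≤ 2 ^ (2 + n)
  kraft n T = *-monoʳ-≤ 2 (≤-trans (Ev.total-weight n T) (event-count n T))

  module Al n = Allocation (Ev.weight n) (2 + n) (Ev.weight-power n) (kraft n)

  eventF : Fn n → Fn n → Fn n
  eventF d e = ext (body ⊙ (d ∷ e ∷ [])) (λ xs → event (fun d xs) (fun e xs)) (λ xs → event-def (fun d xs) (fun e xs))
    where
    body : Fn 2
    body = iszF (distF (var (suc zero)) (pairF (π₁F (var (suc zero))) (π₂F (var (suc zero))))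
      +F distF (lenF (π₁F (var (suc zero)))) (var zero)
      +F iszF (runF U (π₂F (var (suc zero))) (π₁F (var (suc zero))) zeroF)
      +F sumF (π₂F (var (suc zero))) (runF U (var zero) (π₁F (var (suc (suc zero)))) zeroF))

  outputF : Fn n → Fn n
  outputF e = ext (predF (runF U (π₂F e) (π₁F e) zeroF)) (λ xs → output (fun e xs)) (λ xs → output-def (fun e xs))

  indexF : Fn n → Fn n → Fn n → Fn n
  indexF c a t = ext (body ⊙ (c ∷ a ∷ t ∷ [])) (λ xs → Ev.index (fun c xs) (fun a xs) (fun t xs)) (λ xs → refl)
    where
    body : Fn 3
    body = sumF (var (suc (suc zero))) (eventF (var (suc zero)) (var zero)
      *F iszF (distF (π₁F (outputF (var zero))) (var (suc (suc zero)))))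

  lpF : Fn n → Fn n
  lpF e = ifzF e zeroF (2^F lenF (predF e))

  weightF : Fn n → Fn n → Fn n
  weightF c t = ext (eventF c t *F (lpF (sucF i) ∸F lpF i)) (λ xs → Ev.weight (fun c xs) (fun t xs)) (λ xs → refl)
    where
    i : Fn _
    i = indexF c (π₁F (outputF t)) t

  offsetF : Fn n → Fn n → Fn n
  offsetF c t = ext (body ⊙ (c ∷ t ∷ [])) (λ xs → Al.offset (fun c xs) (fun t xs)) (λ xs → refl)
    where
    body : Fn 2
    body = 2^F sucF (sucF (var zero)) +F constF 2 *F sumF (var (suc zero)) (weightF (var (suc zero)) (var zero))

  -- A prefix-free machine that realises the codewords.

  defect : ℕ → ℕ → ℕ → ℕ
  defect n u x = isz (Ev.weight n u) + (Al.offset n u ∸ x * Ev.weight n u) + (suc (x * Ev.weight n u) ∸ (Al.offset n u + Ev.weight n u))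

  defect≡0⇒Codeword : ∀ n u x → defect n u x ≡ 0 → Al.Codeword n u x
  defect≡0⇒Codeword n u x eq =
      (λ w≡0 → 1+n≢0 (trans (cong isz (sym w≡0)) (m+n≡0⇒m≡0 (isz (Ev.weight n u)) eq′)))
    , m∸n≡0⇒m≤n (m+n≡0⇒n≡0 (isz (Ev.weight n u)) eq′)
    , m∸n≡0⇒m≤n (m+n≡0⇒n≡0 (isz (Ev.weight n u) + (Al.offset n u ∸ x * Ev.weight n u)) eq)
    where
    eq′ : isz (Ev.weight n u) + (Al.offset n u ∸ x * Ev.weight n u) ≡ 0
    eq′ = m+n≡0⇒m≡0 _ eq

  Codeword⇒defect≡0 : ∀ n u x → Al.Codeword n u x → defect n u x ≡ 0
  Codeword⇒defect≡0 n u x (ne , lower , upper) = cong₂ _+_ (cong₂ _+_ (isz-≢0 (Ev.weight n u) ne) (m≤n⇒m∸n≡0 lower)) (m≤n⇒m∸n≡0 upper)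
    where
    isz-≢0 : ∀ x → x ≢ 0 → isz x ≡ 0
    isz-≢0 zero    ne = ⊥-elim (ne refl)
    isz-≢0 (suc x) ne = refl

  opaque
    decodeF : Fn 3
    decodeF = ext (ifzF (iszF w +F (o ∸F x *F w) +F (sucF (x *F w) ∸F (o +F w))) (sucF (π₁F (outputF (var zero)))) zeroF)
      (λ { (u ∷ p ∷ n ∷ []) → ifz (defect n u (suc p)) (suc (label u)) 0 }) (λ { (u ∷ p ∷ n ∷ []) → refl })
      where
      w o x : Fn 3
      w = weightF (var (suc (suc zero))) (var zero)
      o = offsetF (var (suc (suc zero))) (var zero)
      -- The machine sees `num p`, while codewords are stated for `N p`, its successor.
      x = sucF (var (suc zero))

    decodeF-fun : ∀ u p n → fun decodeF (u ∷ p ∷ n ∷ []) ≡ ifz (defect n u (suc p)) (suc (label u)) 0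
    decodeF-fun u p n = refl

  decoder : Machine
  decoder = searcher decodeF

  decode-Codeword : ∀ p n u {y} → fun decodeF (u ∷ num p ∷ n ∷ []) ≡ suc y → Al.Codeword n u (N p) × y ≡ label u
  decode-Codeword p n u eq with ifz-suc-0 (defect n u (suc (num p))) (trans (sym (decodeF-fun u (num p) n)) eq)
  ... | eq′ , refl = subst (Al.Codeword n u) (suc-num p) (defect≡0⇒Codeword n u (suc (num p)) eq′) , refl

  opaque
    -- A halting run always comes from a stage at which the program passed the codeword test. Every
    -- condition is read as some number `n`, and the allocation is valid for all `n`.
    decoder-prefixFree : PrefixFree decoder
    decoder-prefixFree x p q y z (k , runs) (k′ , runs′)
      with searcher-finds decodeF (num p ∷ num x ∷ []) (k , runs) | searcher-finds decodeF (num (p ++ q) ∷ num x ∷ []) (k′ , runs′)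
    ... | u , eq | u′ , eq′ = proj₂ (Al.codeword-prefix (num x) u u′ p q
      (proj₁ (decode-Codeword p (num x) u eq)) (proj₁ (decode-Codeword (p ++ q) (num x) u′ eq′)))

  decoder-runs : ∀ p n u a → Al.Codeword n u (N p) → label u ≡ num a → Runs decoder p (str n) a
  decoder-runs p n u a cw label≡ = ⇓⇒Runs p (str n) a
    (searcher-computes decodeF (num p ∷ n ∷ []) {u} found unique) refl (sym (num-str n)) label≡
    where
    found : fun decodeF (u ∷ num p ∷ n ∷ []) ≡ suc (label u)
    found = trans (decodeF-fun u (num p) n) (cong (λ d → ifz d (suc (label u)) 0)
      (Codeword⇒defect≡0 n u (suc (num p)) (subst (Al.Codeword n u) (sym (suc-num p)) cw)))
    unique : ∀ v {z} → fun decodeF (v ∷ num p ∷ n ∷ []) ≡ suc z → z ≡ label u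
    unique v eq with decode-Codeword p n v eq
    ... | cw′ , refl = cong label (sym (proj₁ (Al.codeword-prefix n u v p [] cw
      (subst (λ s → Al.Codeword n v (N s)) (sym (++-identityʳ p)) cw′))))

  -- Describing the second component by its index in the class of the first.

  mismatch : ℕ → ℕ → ℕ → ℕ → ℕ
  mismatch u p a n = isz (event n u) + dist (label u) a + dist (Ev.index n a u) p

  opaque
    pickF : Fn 3
    pickF = ext (ifzF (iszF (eventF c u) +F distF (π₁F (outputF u)) a +F distF (indexF c a u) (var (suc zero)))
        (sucF (π₂F (outputF u))) zeroF)
      (λ { (u ∷ p ∷ x ∷ []) → ifz (mismatch u p (π₁ x) (π₂ x)) (suc (π₂ (output u))) 0 }) (λ { (u ∷ p ∷ x ∷ []) → refl })
      where
      u a c : Fn 3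
      u = var zero
      a = π₁F (var (suc (suc zero)))
      c = π₂F (var (suc (suc zero)))

    pickF-fun : ∀ u p a n → fun pickF (u ∷ p ∷ ⟪ a , n ⟫ ∷ []) ≡ ifz (mismatch u p a n) (suc (π₂ (output u))) 0
    pickF-fun u p a n = cong₂ (λ x y → ifz (mismatch u p x y) (suc (π₂ (output u))) 0) (π₁-⟪⟫ a n) (π₂-⟪⟫ a n)

  picker : Machine
  picker = searcher pickF

  -- Within the class of `a` the index determines the event, so every matching stage is `u`.
  picker-runs : ∀ n u a b → event n u ≢ 0 → label u ≡ num a → π₂ (output u) ≡ num b →
    Runs picker (str (Ev.index n (num a) u)) (pair a (str n)) b
  picker-runs n u a b ne label≡ output≡ = ⇓⇒Runs (str i) (pair a (str n)) b
    (searcher-computes pickF (i ∷ ⟪ num a , n ⟫ ∷ []) {u} found unique)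
    (sym (num-str i)) (sym (trans (num-pair a (str n)) (cong ⟪ num a ,_⟫ (num-str n)))) output≡
    where
    i : ℕ
    i = Ev.index n (num a) u
    match : mismatch u i (num a) n ≡ 0
    match = cong₂ _+_ (cong₂ _+_ (cong isz (Ev.e≢0⇒1 n u ne))
      (trans (cong (λ z → dist z (num a)) label≡) (dist-refl (num a)))) (dist-refl i)
    found : fun pickF (u ∷ i ∷ ⟪ num a , n ⟫ ∷ []) ≡ suc (π₂ (output u))
    found = trans (pickF-fun u i (num a) n) (cong (λ d → ifz d (suc (π₂ (output u))) 0) match)
    unique : ∀ v {z} → fun pickF (v ∷ i ∷ ⟪ num a , n ⟫ ∷ []) ≡ suc z → z ≡ π₂ (output u)
    unique v eq with ifz-suc-0 (mismatch v i (num a) n) (trans (sym (pickF-fun v i (num a) n)) eq)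
    ... | eq₁ , refl = cong (λ w → π₂ (output w)) (sym (Ev.index-injective n u v ne label≡
        (λ e≡0 → 1+n≢0 (trans (cong isz (sym e≡0)) (m+n≡0⇒m≡0 (isz (event n v)) eq₂)))
        (dist≡0 _ _ (m+n≡0⇒n≡0 (isz (event n v)) eq₂))
        (sym (dist≡0 _ _ (m+n≡0⇒n≡0 (isz (event n v) + dist (label v) (num a)) eq₁)))))
      where
      eq₂ : isz (event n v) + dist (label v) (num a) ≡ 0
      eq₂ = m+n≡0⇒m≡0 _ eq₁

  opaque
    -- The index `i` of the event `u` of `r` describes `b`; the codeword for `a` belongs to `v`, the
    -- event of the same class at the last jump up to `i`. Its length is `2 + length r - j` while
    -- `len i` is at most `suc j`, so `j` cancels in the sum.
    codes-exist : ∀ r a b → Runs U r [] (pair a b) → ∃ λ p → ∃ λ q →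
      Runs decoder p (str (length r)) a × Runs picker q (pair a (str (length r))) b × length p + length q ≤ 3 + length r
    codes-exist r a b runs with program-event r a b runs
    ... | u , ne , label≡ , output≡ with last-jump (Ev.index (length r) (num a) u)
    -- Counting up to stage `suc u` admits the case `y = i`, in which `u` itself makes the
    -- reservation.
    ... | y , j , y≤i , jump≡ , len≤ with Ev.index-attained (length r) (num a) (suc u) y
            (≤-<-trans y≤i (≤-reflexive (sym (Ev.index-suc (length r) u ne label≡))))
    ... | v , ne′ , label′≡ , index≡ with weight≡
      where
      weight≡ : Ev.weight (length r) v ≡ 2 ^ j
      weight≡ = trans (cong₂ _*_ (Ev.e≢0⇒1 (length r) v ne′)
        (trans (cong jump (trans (cong (λ z → Ev.index (length r) z v) label′≡) index≡)) jump≡)) (*-identityˡ (2 ^ j))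
    ... | weight≡ with Al.codeword-exists (length r) v (λ eq → <⇒≢ (m^n>0 2 j) (trans (sym eq) weight≡))
    ... | p , cw = p , str i , decoder-runs p (length r) v a cw label′≡ , picker-runs (length r) u a b ne label≡ output≡ , (begin
        length p + length (str i)     ≡⟨ cong (length p +_) (length-str i) ⟩
        length p + len i              ≤⟨ +-monoʳ-≤ (length p) len≤ ⟩
        length p + suc j              ≡⟨ +-suc (length p) j ⟩
        suc (length p + j)            ≡⟨ cong suc (Al.codeword-length (length r) v p j weight≡ cw) ⟩
        3 + length r                  ∎)
      where
      open ≤-Reasoning
      i : ℕ
      i = Ev.index (length r) (num a) u

split-bound : (U V : Machine) → Optimal U → OptimalPF V →
  ∃ λ c → ∀ a b n m k → IsComplexity U (pair a b) [] n → IsComplexity V a (str n) m → IsComplexity U b (pair a (str n)) k →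
    m + k ≤ n + c
split-bound U V optU (_ , optV) with optV (Halting.decoder U) (Halting.decoder-prefixFree U) | optU (Halting.picker U)
... | c , simulate | c′ , simulate′ = 3 + (c + c′) , bound
  where
  bound : ∀ a b n m k → IsComplexity U (pair a b) [] n → IsComplexity V a (str n) m → IsComplexity U b (pair a (str n)) k →
    m + k ≤ n + (3 + (c + c′))
  bound a b n m k ((r , runs , refl) , _) (_ , minimal) (_ , minimal′) with Halting.codes-exist U r a b runs
  ... | p , q , runs-p , runs-q , short with simulate p (str n) a runs-p | simulate′ q (pair a (str n)) b runs-q
  ... | p′ , runs-p′ , p′≤ | q′ , runs-q′ , q′≤ = begin
    m + k
      ≤⟨ +-mono-≤ (≤-trans (minimal p′ runs-p′) p′≤) (≤-trans (minimal′ q′ runs-q′) q′≤) ⟩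
    (length p + c) + (length q + c′)
      ≡⟨ solve 4 (λ p c q d → (p :+ c) :+ (q :+ d) := (p :+ q) :+ (c :+ d)) refl (length p) c (length q) c′ ⟩
    (length p + length q) + (c + c′)       ≤⟨ +-monoˡ-≤ (c + c′) short ⟩
    (3 + length r) + (c + c′)
      ≡⟨ solve 2 (λ x y → (con 3 :+ x) :+ y := x :+ (con 3 :+ y)) refl (length r) (c + c′) ⟩
    length r + (3 + (c + c′))              ∎
    where
    open ≤-Reasoning
    open +-*-Solver

-- The two bounds combined.

≤+⇒∣-∣≤ : ∀ x y c → x ≤ y + c → y ≤ x + c → ∣ x - y ∣ ≤ c
≤+⇒∣-∣≤ x y c x≤ y≤ with ∣m-n∣≡[m∸n]∨[n∸m] x y
... | inj₁ eq = ≤-trans (≤-reflexive eq) (m≤n+o⇒m∸n≤o x y x≤)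
... | inj₂ eq = ≤-trans (≤-reflexive eq) (m≤n+o⇒m∸n≤o y x y≤)

theorem1 : (U V : Machine) → Optimal U → OptimalPF V →
    ∃ λ c → ∀ a b n m k →
    IsComplexity U (pair a b) [] n →
    IsComplexity V a (str n) m →
    IsComplexity U b (pair a (str n)) k →
    ∣ n - (m + k) ∣ ≤ c
theorem1 U V optU optV with joint-bound U V optU optV | split-bound U V optU optV
... | c , joint | c′ , split = c ⊔ c′ , λ a b n m k Cab Ka Cb → ≤+⇒∣-∣≤ n (m + k) (c ⊔ c′)
  (≤-trans (joint a b n m k Cab Ka Cb) (+-monoʳ-≤ (m + k) (m≤m⊔n c c′)))
  (≤-trans (split a b n m k Cab Ka Cb) (+-monoʳ-≤ n (m≤n⊔m c c′)))
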